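{- For all integers $\alpha\ge0$ and $n\ge0$, \begin{align*} b_{5}\!\left(4\cdot5^{2\alpha+1}n+\tfrac{31\cdot 5^{2\alpha}-1}{6}\right)&\equiv 0\pmod 2,\\ b_{5}\!\left(4\cdot5^{2\alpha+1}n+\tfrac{79\cdot 5^{2\alpha}-1}{6}\right)&\equiv 0\pmod 2,\\ b_{5}\!\left(4\cdot5^{2\alpha+2}n+\tfrac{83\cdot 5^{2\alpha+1}-1}{6}\right)&\equiv 0\pmod 2,\\ b_{5}\!\left(4\cdot5^{2\alpha+2}n+\tfrac{107\cdot 5^{2\alpha+1}-1}{6}\right)&\equiv 0\pmod 2. \end{align*}
   Context: For a positive integer $\ell$, $b_\ell(n)$ denotes the number of partitions of $n$ having no part divisible by $\ell$. -}

module Defs where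

open import Data.Nat
open import Data.Nat.Properties
open import Data.Nat.DivMod
open import Data.Nat.Divisibility using (_∣_; _∣?_; divides)
open import Data.List using (List; []; _∷_; _++_; map; filter; length)
open import Data.Nat.ListAction using (sum)
open import Data.List.Properties using (∷-injectiveˡ; ∷-injectiveʳ)
open import Data.List.Membership.Propositional using (_∈_)
open import Data.List.Membership.Propositional.Properties
open import Data.List.Relation.Unary.All as All using (All; []; _∷_)
open import Data.List.Relation.Unary.AllPairs using ([]; _∷_)
open import Data.List.Relation.Unary.Any using (here)
open import Data.List.Relation.Unary.Linked as Linked using (Linked)
open import Data.List.Relation.Unary.Unique.Propositional using (Unique)
import Data.List.Relation.Unary.Unique.Propositional.Properties as Unique
open import Data.Product using (_×_; _,_; ∃₂)
open import Data.Sum using (inj₁; inj₂)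
open import Function using (_⇔_; mk⇔)
open import Relation.Nullary using (¬_; Dec; ¬?)
open import Relation.Binary.PropositionalEquality

-- A partition of n is the list of its parts in weakly decreasing order.
record IsPartition (n : ℕ) (p : List ℕ) : Set where
  field
    positive   : All (0 <_) p
    decreasing : Linked _≥_ p
    total      : sum p ≡ n

Regular : ℕ → List ℕ → Set
Regular ℓ = All (λ k → ¬ ℓ ∣ k)

regular? : ∀ ℓ p → Dec (Regular ℓ p)
regular? ℓ = All.all? (λ k → ¬? (ℓ ∣? k))

-- The compositions (ordered lists of positive parts) of 1 + h + n whose
-- first part exceeds h: that part is either larger than 1 + h, or equal to it.
compositionsFrom : ℕ → ℕ → List (List ℕ)
compositionsFrom h zero    = (suc h ∷ []) ∷ []
compositionsFrom h (suc n) =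
  compositionsFrom (suc h) n ++ map (suc h ∷_) (compositionsFrom 0 n)

compositions : ℕ → List (List ℕ)
compositions zero    = [] ∷ []
compositions (suc n) = compositionsFrom 0 n

-- See ∈-partitions and partitions-unique: every partition of n occurs here
-- exactly once, and nothing else does.
partitions : ℕ → List (List ℕ)
partitions n = filter (Linked.linked? _≥?_) (compositions n)

b : (ℓ : ℕ) .{{_ : NonZero ℓ}} → ℕ → ℕ
b ℓ n = length (filter (regular? ℓ) (partitions n))

private
  Shape : ℕ → ℕ → List ℕ → Set
  Shape h n p = ∃₂ λ k ks →
    p ≡ k ∷ ks × h < k × All (0 <_) ks × k + sum ks ≡ suc (h + n)

  from-sound : ∀ h n {p} → p ∈ compositionsFrom h n → Shape h n p
  from-sound h zero (here refl) = suc h , [] , refl , ≤-refl , [] , refl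
  from-sound h (suc n) p∈ with ∈-++⁻ (compositionsFrom (suc h) n) p∈
  ... | inj₁ q∈ with from-sound (suc h) n q∈
  ...   | k , ks , eq , h<k , pos , s =
          k , ks , eq , <-trans (n<1+n h) h<k , pos ,
          trans s (cong suc (sym (+-suc h n)))
  from-sound h (suc n) p∈ | inj₂ q∈ with ∈-map⁻ (suc h ∷_) q∈
  ... | q , q∈′ , refl with from-sound 0 n q∈′
  ...   | k , ks , refl , 0<k , pos , s =
          suc h , k ∷ ks , refl , ≤-refl , 0<k ∷ pos , cong (suc h +_) s

  from-complete : ∀ h n k ks → h < k → All (0 <_) ks →
                  k + sum ks ≡ suc (h + n) → (k ∷ ks) ∈ compositionsFrom h n
  from-complete h n k ks h<k pos s with m≤n⇒m<n∨m≡n h<k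
  from-complete h zero k ks _ pos s | inj₁ h+1<k =
    contra (<-≤-trans h+1<k (≤-trans (m≤m+n k (sum ks)) (≤-reflexive (trans s (cong suc (+-identityʳ h))))))
    where
    contra : ∀ {A : Set} → suc h < suc h → A
    contra lt with () ← <-irrefl refl lt
  from-complete h (suc n) k ks _ pos s | inj₁ h+1<k =
    ∈-++⁺ˡ (from-complete (suc h) n k ks h+1<k pos (trans s (cong suc (+-suc h n))))
  from-complete h n .(suc h) ks _ pos s | inj₂ refl
    with n | ks | pos | +-cancelˡ-≡ (suc h) (sum ks) n s
  ... | zero   | []     | _         | _  = here refl
  ... | suc n′ | j ∷ js | 0<j ∷ pos′ | s′ =
        ∈-++⁺ʳ (compositionsFrom (suc h) n′)
          (∈-map⁺ (suc h ∷_) (from-complete 0 n′ j js 0<j pos′ s′))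
  ... | zero   | suc _ ∷ _  | _         | ()
  ... | zero   | zero ∷ _   | () ∷ _    | _

  from-unique : ∀ h n → Unique (compositionsFrom h n)
  from-unique h zero    = [] ∷ []
  from-unique h (suc n) = Unique.++⁺ (from-unique (suc h) n)
    (Unique.map⁺ ∷-injectiveʳ (from-unique 0 n)) disjoint
    where
    disjoint : ∀ {p} → ¬ (p ∈ compositionsFrom (suc h) n ×
                          p ∈ map (suc h ∷_) (compositionsFrom 0 n))
    disjoint (l , r) with from-sound (suc h) n l | ∈-map⁻ (suc h ∷_) r
    ... | k , ks , refl , lt , _ | q , _ , eq = <-irrefl (sym (∷-injectiveˡ eq)) lt

  compositions-sound : ∀ n {p} → p ∈ compositions n → All (0 <_) p × sum p ≡ n
  compositions-sound zero (here refl) = [] , refl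
  compositions-sound (suc n) p∈ with from-sound 0 n p∈
  ... | k , ks , refl , 0<k , pos , s = 0<k ∷ pos , s

  compositions-complete : ∀ n {p} → All (0 <_) p → sum p ≡ n → p ∈ compositions n
  compositions-complete zero    {[]}        _           _ = here refl
  compositions-complete zero    {suc _ ∷ _} _           ()
  compositions-complete zero    {zero ∷ _}  (() ∷ _)    _
  compositions-complete (suc n) {k ∷ ks}    (0<k ∷ pos) s =
    from-complete 0 n k ks 0<k pos s

  compositions-unique : ∀ n → Unique (compositions n)
  compositions-unique zero    = [] ∷ []
  compositions-unique (suc n) = from-unique 0 n

∈-partitions : ∀ n {p} → p ∈ partitions n ⇔ IsPartition n p
∈-partitions n = mk⇔
  (λ p∈ → let c , d = ∈-filter⁻ (Linked.linked? _≥?_) {xs = compositions n} p∈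
              pos , s = compositions-sound n c
          in record { positive = pos ; decreasing = d ; total = s })
  (λ ip → let open IsPartition ip in
          ∈-filter⁺ (Linked.linked? _≥?_)
            (compositions-complete n positive total) decreasing)

partitions-unique : ∀ n → Unique (partitions n)
partitions-unique n = Unique.filter⁺ (Linked.linked? _≥?_) (compositions-unique n)

-- The quotients (c · 5^m − 1) / 6 in the theorem are exact, so that truncated
-- subtraction and integer division on ℕ agree with the rational expressions.
private
  25^%6 : ∀ α → (25 ^ α) % 6 ≡ 1
  25^%6 zero    = refl
  25^%6 (suc α) = trans (%-distribˡ-* 25 (25 ^ α) 6)
                        (cong (λ r → (1 * r) % 6) (25^%6 α))

  5^even%6 : ∀ α → (5 ^ (2 * α)) % 6 ≡ 1
  5^even%6 α = trans (cong (_% 6) (sym (^-*-assoc 5 2 α))) (25^%6 α)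

  5^odd%6 : ∀ α → (5 ^ (2 * α + 1)) % 6 ≡ 5
  5^odd%6 α = trans (cong (_% 6) (^-distribˡ-+-* 5 (2 * α) 1))
    (trans (%-distribˡ-* (5 ^ (2 * α)) 5 6)
           (cong (λ r → (r * 5) % 6) (5^even%6 α)))

  6∣∸1 : ∀ m → m % 6 ≡ 1 → 6 ∣ m ∸ 1
  6∣∸1 m r = divides (m / 6)
    (cong (_∸ 1) (trans (m≡m%n+[m/n]*n m 6) (cong (_+ (m / 6) * 6) r)))

exact-even : ∀ c α → c % 6 ≡ 1 → 6 ∣ c * 5 ^ (2 * α) ∸ 1
exact-even c α r = 6∣∸1 (c * 5 ^ (2 * α)) (trans (%-distribˡ-* c (5 ^ (2 * α)) 6)
  (cong₂ (λ x y → (x * y) % 6) r (5^even%6 α)))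

exact-odd : ∀ c α → c % 6 ≡ 5 → 6 ∣ c * 5 ^ (2 * α + 1) ∸ 1
exact-odd c α r = 6∣∸1 (c * 5 ^ (2 * α + 1)) (trans (%-distribˡ-* c (5 ^ (2 * α + 1)) 6)
  (cong₂ (λ x y → (x * y) % 6) r (5^odd%6 α)))

{-# OPTIONS --safe #-}
-- Write f_k = ∏_{j ≥ 1} (1 + q^{kj}) over 𝔽₂, so that the generating function G of b₅ satisfies G f₁ = f₅.
-- By the triple product, f₁ f₅ = f(q, q⁴) f(q², q³), while f_k³ is the theta series of the triangular numbers
-- in q^k and ∑ q^{k t²} = 1.  This turns f₁ f₅ = f₂³ + q f₁₀³ into an identity counting the Gaussian integers
-- u + v i with u ≡ 1 (mod 4) of norm 4n + 1: those divisible by 1 - 2i give the last term, the others become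
-- ≡ 1 modulo 1 - 2i after multiplication by a unit.  Since f₂ = f₁² and f₁₀ = f₅², iterating the identity gives
-- G = f₁⁴ + q f₈ f₂₀ + q³ (f₅⁴ / f₁)⁴, where only the middle term has exponents ≡ 1 (mod 4).  By the pentagonal
-- number theorem, b₅(N) odd with N ≡ 1 (mod 4) forces 6N + 1 = 2x² + 5y², which descent modulo 5 excludes.
module Submission where

open import Defs
open import Algebra.Bundles using (CommutativeRing; RawRing)
import Algebra.Properties.AbelianGroup
import Algebra.Solver.Ring as RingSolver
import Algebra.Solver.Ring.AlmostCommutativeRing as ACR
open import Algebra.Structures using (IsCommutativeRing)
open import Data.Bool using (Bool; true; false; _∧_; _xor_; not)
open import Data.Bool.Properties
  using (∧-comm; ∧-assoc; ∧-distribˡ-xor; ∧-distribʳ-xor; xor-assoc; xor-comm; xor-identityʳ; xor-same;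
         not-involutive; not-distribˡ-xor; xor-∧-commutativeRing)
  renaming (_≟_ to _≟ᵇ_)
open import Data.Fin as Fin using (Fin; toℕ; fromℕ<)
open import Data.Fin.Patterns using (0F; 1F; 2F; 3F; 4F)
import Data.Fin.Properties as Fin
open import Data.Integer as ℤ using (ℤ; +_; -[1+_]; ∣_∣; _⊖_)
import Data.Integer.DivMod as ℤ
import Data.Integer.Properties as ℤ
open import Data.Integer.Solver using (module +-*-Solver)
import Data.Integer.Tactic.RingSolver as ℤRing
open import Data.List using (List; []; _∷_; _++_; applyUpTo; cartesianProduct; filter; length; map)
open import Data.List.Membership.Propositional using (_∈_)
import Data.List.Membership.Propositional.Properties as ∈
open import Data.List.Membership.Propositional.Properties.WithK using (unique∧set⇒bag)
open import Data.List.Properties using (filter-accept; filter-reject; length-++; length-map; ∷-injectiveʳ)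
open import Data.List.Relation.Binary.BagAndSetEquality using (∼bag⇒↭)
open import Data.List.Relation.Binary.Permutation.Propositional as ↭ using (_↭_)
open import Data.List.Relation.Binary.Permutation.Propositional.Properties using (↭-length)
open import Data.List.Relation.Unary.All as All using (All; []; _∷_)
open import Data.List.Relation.Unary.Any using (here)
open import Data.List.Relation.Unary.Linked using (Linked; []; [-]; _∷_)
open import Data.List.Relation.Unary.Unique.Propositional using (Unique)
import Data.List.Relation.Unary.Unique.Propositional.Properties as Unique
open import Data.Maybe using (just; nothing)
open import Data.Nat as ℕ
  using (ℕ; zero; suc; _<_; _≤_; _≥_; z≤n; s≤s; NonZero; _^_; _∸_; _/_; _%_; _≤?_)
open import Data.Nat.Divisibility using (_∣_; divides; _∣?_)
import Data.Nat.Divisibility as ℕ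
import Data.Nat.DivMod as ℕ
open import Data.Nat.ListAction using (sum)
open import Data.Nat.Primality using (Prime; prime?; euclidsLemma)
import Data.Nat.Properties as ℕ
import Data.Nat.Tactic.RingSolver as ℕRing
open import Data.Product using (_×_; _,_; ∃; ∃₂; proj₁; proj₂)
open import Data.Product.Algebra using (×-assoc)
open import Data.Product.Function.NonDependent.Propositional using (_×-↔_)
open import Data.Sum using (_⊎_; inj₁; inj₂; [_,_]; [_,_]′)
open import Data.Sum.Function.Propositional using (_⊎-↔_)
open import Data.Sum.Properties using (inj₁-injective; inj₂-injective)
open import Function using (_∘_; id; _↔_; Equivalence; Inverse; mk⇔; mk↔ₛ′)
open import Function.Construct.Composition using (_↔-∘_)
open import Function.Construct.Identity using (↔-id)
open import Function.Construct.Symmetry using (↔-sym)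
open import Level using (0ℓ)
open import Relation.Binary.Definitions using (WeaklyDecidable)
open import Relation.Binary.PropositionalEquality hiding (setoid; J; [_])
import Relation.Binary.Reasoning.Setoid as SetoidReasoning
open import Relation.Nullary using (¬_; ¬?; Dec; yes; no; contradiction)
open import Relation.Nullary.Decidable using (_×-dec_; from-yes; from-no)

-- Power series over 𝔽₂

-- All series are compared modulo `q^N`, with N fixed only when a coefficient of G is read off. This
-- keeps everything finite: products have N factors, theta series are sums over finite lists, and
-- re-indexing such a series is a bijection of index sets. In characteristic 2, 1 + q^k is also 1 -
-- q^k, so the triple product and the Gaussian binomials are the classical ones without signs.
--
-- The obstacle in f₁ f₅ = f₂³ + q f₁₀³ is one of dimension: the left side is a sum over a plane
-- lattice, both terms on the right are sums over a line. The factors ∑ q^{t²} = 1 and ∑ q^{5t²} = 1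
-- supply the missing variable, and what remains holds without any cancellation, by a bijection
-- between ℤ² ⊎ ℤ² and ℤ². It exists because i has order 4 modulo 1 - 2i: the four units meet each
-- nonzero residue class exactly once.
--
-- A dissection modulo 4 is the right tool because in all four progressions 6N + 1 ≡ 7 (mod 24),
-- that is, N ≡ 1 (mod 4).

module PowerSeries where

  Series : Set
  Series = ℕ → Bool

  infixl 6 _+_
  infixl 7 _*_

  tail : Series → Series
  tail f n = f (suc n)

  0ₛ 1ₛ q : Series
  0ₛ _       = false
  1ₛ zero    = true
  1ₛ (suc _) = false
  q zero     = false
  q (suc n)  = 1ₛ n

  -- Opaque, since otherwise an equation between unapplied sums is η-expanded
  -- and no longer determines the summands.
  opaque
    _+_ : Series → Series → Series
    (f + g) n = f n xor g n

    +-coefficient : ∀ f g n → (f + g) n ≡ f n xor g n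
    +-coefficient f g n = refl

  _*_ : Series → Series → Series
  (f * g) zero    = f 0 ∧ g 0
  (f * g) (suc n) = (f 0 ∧ g (suc n)) xor (tail f * g) n

  xor-interchange : ∀ a b c d → (a xor b) xor (c xor d) ≡ (a xor c) xor (b xor d)
  xor-interchange a b c d = trans (xor-assoc a b (c xor d))
    (trans (cong (a xor_) (trans (sym (xor-assoc b c d))
       (trans (cong (_xor d) (xor-comm b c)) (xor-assoc c b d))))
     (sym (xor-assoc a c (b xor d))))

  *-cong≤ : ∀ {f f′ g g′} n → (∀ {i} → i ≤ n → f i ≡ f′ i) → (∀ {i} → i ≤ n → g i ≡ g′ i) →
            (f * g) n ≡ (f′ * g′) n
  *-cong≤ zero    p r = cong₂ _∧_ (p z≤n) (r z≤n)
  *-cong≤ (suc n) p r = cong₂ _xor_ (cong₂ _∧_ (p z≤n) (r ℕ.≤-refl))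
    (*-cong≤ n (p ∘ s≤s) (r ∘ ℕ.m≤n⇒m≤1+n))

  -- The definition of the product peels off the summand with `f 0`. Peeling off the one with `g 0`
  -- instead is what commutativity needs.
  *-sucʳ : ∀ f g n → (f * g) (suc n) ≡ (f (suc n) ∧ g 0) xor (f * tail g) n
  *-sucʳ f g zero    = xor-comm (f 0 ∧ g 1) (f 1 ∧ g 0)
  *-sucʳ f g (suc n) =
    trans (cong (f 0 ∧ g (2 ℕ.+ n) xor_) (*-sucʳ (tail f) g n))
    (trans (sym (xor-assoc (f 0 ∧ g (2 ℕ.+ n)) (f (2 ℕ.+ n) ∧ g 0) ((tail f * tail g) n)))
    (trans (cong (_xor (tail f * tail g) n) (xor-comm (f 0 ∧ g (2 ℕ.+ n)) (f (2 ℕ.+ n) ∧ g 0)))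
           (xor-assoc (f (2 ℕ.+ n) ∧ g 0) (f 0 ∧ g (2 ℕ.+ n)) ((tail f * tail g) n))))

  *-comm′ : ∀ f g n → (f * g) n ≡ (g * f) n
  *-comm′ f g zero    = ∧-comm (f 0) (g 0)
  *-comm′ f g (suc n) = trans (cong₂ _xor_ (∧-comm (f 0) (g (suc n))) (*-comm′ (tail f) g n))
                              (sym (*-sucʳ g f n))

  *-scale : ∀ c f g n → ((λ i → c ∧ f i) * g) n ≡ c ∧ (f * g) n
  *-scale c f g zero    = ∧-assoc c (f 0) (g 0)
  *-scale c f g (suc n) = trans (cong₂ _xor_ (∧-assoc c (f 0) (g (suc n))) (*-scale c (tail f) g n))
    (sym (∧-distribˡ-xor c (f 0 ∧ g (suc n)) ((tail f * g) n)))

  opaque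
    unfolding _+_

    *-distribʳ′ : ∀ h f g n → ((f + g) * h) n ≡ (f * h) n xor (g * h) n
    *-distribʳ′ h f g zero    = ∧-distribʳ-xor (h 0) (f 0) (g 0)
    *-distribʳ′ h f g (suc n) =
      trans (cong₂ _xor_ (∧-distribʳ-xor (h (suc n)) (f 0) (g 0)) (*-distribʳ′ h (tail f) (tail g) n))
            (xor-interchange (f 0 ∧ h (suc n)) (g 0 ∧ h (suc n)) ((tail f * h) n) ((tail g * h) n))

    *-assoc′ : ∀ f g h n → ((f * g) * h) n ≡ (f * (g * h)) n
    *-assoc′ f g h zero    = ∧-assoc (f 0) (g 0) (h 0)
    *-assoc′ f g h (suc n) =
      trans (cong (((f 0 ∧ g 0) ∧ h (suc n)) xor_)
        (trans (*-distribʳ′ h (λ i → f 0 ∧ g (suc i)) (tail f * g) n)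
          (cong₂ _xor_ (*-scale (f 0) (tail g) h n) (*-assoc′ (tail f) g h n))))
      (trans (sym (xor-assoc ((f 0 ∧ g 0) ∧ h (suc n)) (f 0 ∧ (tail g * h) n) ((tail f * (g * h)) n)))
      (cong (_xor (tail f * (g * h)) n)
        (trans (cong (_xor (f 0 ∧ (tail g * h) n)) (∧-assoc (f 0) (g 0) (h (suc n))))
               (sym (∧-distribˡ-xor (f 0) (g 0 ∧ h (suc n)) ((tail g * h) n))))))

  *-zeroˡ′ : ∀ g n → (0ₛ * g) n ≡ false
  *-zeroˡ′ g zero    = refl
  *-zeroˡ′ g (suc n) = *-zeroˡ′ g n

  *-identityˡ′ : ∀ g n → (1ₛ * g) n ≡ g n
  *-identityˡ′ g zero    = refl
  *-identityˡ′ g (suc n) = trans (cong (g (suc n) xor_) (*-zeroˡ′ g n)) (xor-identityʳ (g (suc n)))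

  *-support : ∀ f g n → (f * g) n ≡ true → ∃₂ λ i j → i ℕ.+ j ≡ n × f i ≡ true × g j ≡ true
  *-support f g zero p with f 0 in eq | g 0 in eq′
  *-support f g zero p | true | true = 0 , 0 , refl , eq , eq′
  *-support f g (suc n) p with f 0 in eq | g (suc n) in eq′
  ... | true  | true  = 0 , suc n , refl , eq , eq′
  ... | true  | false = let i , j , s , u , v = *-support (tail f) g n p in suc i , j , cong suc s , u , v
  ... | false | _     = let i , j , s , u , v = *-support (tail f) g n p in suc i , j , cong suc s , u , v

  opaque
    unfolding _+_

    +-support : ∀ f g {n} {P : Set} → (f n ≡ true → P) → (g n ≡ true → P) → (f + g) n ≡ true → P
    +-support f g {n} l r p with f n | g n
    ... | true  | _    = l refl
    ... | false | true = r refl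

  -- Frobenius: f = f₀ + q f′ gives f² = f₀ + q² f′².
  square-support : ∀ f n → (f * f) n ≡ true → ∃ λ k → n ≡ k ℕ.+ k × f k ≡ true
  square-support f zero p with f 0 in eq
  ... | true = 0 , refl , eq
  square-support f (suc zero) p =
    contradiction (trans (sym p) (trans (cong (f 0 ∧ f 1 xor_) (∧-comm (f 1) (f 0))) (xor-same (f 0 ∧ f 1)))) λ ()
  square-support f (suc (suc n)) p =
    let k , e , u = square-support (tail f) n (trans (sym shift) p)
    in suc k , cong suc (trans (cong suc e) (sym (ℕ.+-suc k k))) , u
    where
    shift : (f * f) (2 ℕ.+ n) ≡ (tail f * tail f) n
    shift = trans (cong (f 0 ∧ f (2 ℕ.+ n) xor_) (*-sucʳ (tail f) f n))
      (trans (sym (xor-assoc (f 0 ∧ f (2 ℕ.+ n)) (f (2 ℕ.+ n) ∧ f 0) ((tail f * tail f) n)))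
      (cong (_xor (tail f * tail f) n)
        (trans (cong (f 0 ∧ f (2 ℕ.+ n) xor_) (∧-comm (f (2 ℕ.+ n)) (f 0))) (xor-same (f 0 ∧ f (2 ℕ.+ n))))))

  q^_ : ℕ → Series
  (q^ zero)  = 1ₛ
  (q^ suc n) = q * q^ n

  q*-coefficient : ∀ f n → (q * f) (suc n) ≡ f n
  q*-coefficient f = *-identityˡ′ f

  q^-support : ∀ e {n} → (q^ e) n ≡ true → e ≡ n
  q^-support zero    {zero}  p = refl
  q^-support (suc e) {suc n} p = cong suc (q^-support e (trans (sym (q*-coefficient (q^ e) n)) p))

  q^*-coefficient : ∀ e f n → (q^ e * f) (e ℕ.+ n) ≡ f n
  q^*-coefficient zero    f n = *-identityˡ′ f n
  q^*-coefficient (suc e) f n = trans (*-assoc′ q (q^ e) f (suc e ℕ.+ n))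
    (trans (q*-coefficient (q^ e * f) (e ℕ.+ n)) (q^*-coefficient e f n))

  q^*-coefficient-< : ∀ e f {n} → n < e → (q^ e * f) n ≡ false
  q^*-coefficient-< (suc e) f {zero}  _         = refl
  q^*-coefficient-< (suc e) f {suc n} (s≤s n<e) = trans (*-assoc′ q (q^ e) f (suc n))
    (trans (q*-coefficient (q^ e * f) n) (q^*-coefficient-< e f n<e))

  qProduct : ℕ → ℕ → ℕ → Series
  qProduct a s zero    = 1ₛ
  qProduct a s (suc n) = qProduct a s n * (1ₛ + (q^ (a ℕ.+ s ℕ.* n)))

  -- The Gaussian binomial coefficient [a + b, a] in base q^s.
  qBinomial : ℕ → ℕ → ℕ → Series
  qBinomial s zero    b       = 1ₛ
  qBinomial s (suc a) zero    = 1ₛ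
  qBinomial s (suc a) (suc b) = qBinomial s a (suc b) + (q^ (s ℕ.* suc a)) * qBinomial s (suc a) b

  antidiagonalSum : ℕ → (ℕ → ℕ → Series) → Series
  antidiagonalSum zero    g = g 0 0
  antidiagonalSum (suc n) g = g 0 (suc n) + antidiagonalSum n (g ∘ suc)

  Θ : {I : Set} → (I → ℕ) → List I → Series
  Θ e []       = 0ₛ
  Θ e (x ∷ xs) = (q^ e x) + Θ e xs

  ∏< : ℕ → (ℕ → Series) → Series
  ∏< zero    f = 1ₛ
  ∏< (suc r) f = ∏< r f * f r

  Θ-support : {I : Set} (e : I → ℕ) (xs : List I) {n : ℕ} → Θ e xs n ≡ true → ∃ λ i → e i ≡ n
  Θ-support e (x ∷ xs) = +-support (q^ e x) (Θ e xs) (λ p → x , q^-support (e x) p) (Θ-support e xs)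

  q^*-support : ∀ k f n → ((q^ k) * f) n ≡ true → ∃ λ m → k ℕ.+ m ≡ n × f m ≡ true
  q^*-support k f n p =
    let i , j , s , u , v = *-support (q^ k) f n p in j , trans (cong (ℕ._+ j) (q^-support k u)) s , v

  fourth-power-support : ∀ f n → (f * f * (f * f)) n ≡ true → 4 ∣ n
  fourth-power-support f n p =
    let k , n≡k+k , u = square-support (f * f) n p
        l , k≡l+l , _ = square-support f k u
    in divides l (trans n≡k+k (trans (cong₂ ℕ._+_ k≡l+l k≡l+l) (rearrange l)))
    where
    rearrange : ∀ l → l ℕ.+ l ℕ.+ (l ℕ.+ l) ≡ l ℕ.* 4
    rearrange = ℕRing.solve-∀

  module Mod (N : ℕ) where

    infix 4 _≈_

    -- A record rather than a bare function type, so that the type of a congruence determines both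
    -- series.
    record _≈_ (f g : Series) : Set where
      constructor agree
      field coefficient : ∀ n → n < N → f n ≡ g n
    open _≈_ public

    opaque
      unfolding _+_

      isCommutativeRing : IsCommutativeRing _≈_ _+_ _*_ id 0ₛ 1ₛ
      isCommutativeRing = record
        { isRing = record
          { +-isAbelianGroup = record
            { isGroup = record
              { isMonoid = record
                { isSemigroup = record
                  { isMagma = record
                    { isEquivalence = record
                      { refl  = agree λ _ _ → refl
                      ; sym   = λ p → agree λ n l → sym (coefficient p n l)
                      ; trans = λ p r → agree λ n l → trans (coefficient p n l) (coefficient r n l)
                      }
                    ; ∙-cong = λ p r → agree λ n l → cong₂ _xor_ (coefficient p n l) (coefficient r n l)
                    }
                  ; assoc = λ f g h → agree λ n _ → xor-assoc (f n) (g n) (h n)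
                  }
                ; identity = (λ f → agree λ _ _ → refl) , (λ f → agree λ n _ → xor-identityʳ (f n))
                }
              ; inverse = (λ f → agree λ n _ → xor-same (f n)) , (λ f → agree λ n _ → xor-same (f n))
              ; ⁻¹-cong = id
              }
            ; comm = λ f g → agree λ n _ → xor-comm (f n) (g n)
            }
          ; *-cong = λ {f} {f′} {g} {g′} p r → agree λ n l → *-cong≤ {f} {f′} {g} {g′} n
              (λ i≤n → coefficient p _ (ℕ.≤-<-trans i≤n l)) (λ i≤n → coefficient r _ (ℕ.≤-<-trans i≤n l))
          ; *-assoc = λ f g h → agree λ n _ → *-assoc′ f g h n
          ; *-identity = (λ f → agree λ n _ → *-identityˡ′ f n)
                       , (λ f → agree λ n _ → trans (*-comm′ f 1ₛ n) (*-identityˡ′ f n))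
          ; distrib = (λ f g h → agree λ n _ → trans (*-comm′ f (g + h) n)
                         (trans (*-distribʳ′ f g h n) (cong₂ _xor_ (*-comm′ g f n) (*-comm′ h f n))))
                    , (λ f g h → agree λ n _ → *-distribʳ′ f g h n)
          }
        ; *-comm = λ f g → agree λ n _ → *-comm′ f g n
        }

    ring : CommutativeRing 0ℓ 0ℓ
    ring = record { isCommutativeRing = isCommutativeRing }

    open CommutativeRing ring public
      using (setoid; +-cong; *-cong; +-congˡ; +-congʳ; *-congˡ; *-congʳ; +-identityʳ; +-identityˡ;
             +-assoc; +-comm; *-assoc; *-comm; *-identityˡ; *-identityʳ; zeroˡ; zeroʳ; distribˡ; distribʳ)
      renaming (refl to ≈-refl; sym to ≈-sym; trans to ≈-trans; reflexive to ≈-reflexive)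

    -- Coefficients in 𝔽₂ let the solver use characteristic 2.
    private
      coefficients : RawRing 0ℓ 0ℓ
      coefficients = CommutativeRing.rawRing xor-∧-commutativeRing

      almostRing : ACR.AlmostCommutativeRing 0ℓ 0ℓ
      almostRing = ACR.fromCommutativeRing ring

      ⟦_⟧ : Bool → Series
      ⟦ false ⟧ = 0ₛ
      ⟦ true  ⟧ = 1ₛ

      opaque
        unfolding _+_

        +-homo : ∀ x y → ⟦ x xor y ⟧ ≈ ⟦ x ⟧ + ⟦ y ⟧
        +-homo false y     = ≈-refl
        +-homo true  false = ≈-sym (+-identityʳ 1ₛ)
        +-homo true  true  = agree λ n _ → sym (xor-same (1ₛ n))

      *-homo : ∀ x y → ⟦ x ∧ y ⟧ ≈ ⟦ x ⟧ * ⟦ y ⟧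
      *-homo false y = ≈-sym (zeroˡ ⟦ y ⟧)
      *-homo true  y = ≈-sym (*-identityˡ ⟦ y ⟧)

      morphism : coefficients ACR.-Raw-AlmostCommutative⟶ almostRing
      morphism = record
        { ⟦_⟧ = ⟦_⟧ ; +-homo = +-homo ; *-homo = *-homo ; -‿homo = λ _ → ≈-refl
        ; 0-homo = ≈-refl ; 1-homo = ≈-refl }

      decide : WeaklyDecidable (ACR.Induced-equivalence morphism)
      decide x y with x ≟ᵇ y
      ... | yes refl = just ≈-refl
      ... | no _     = nothing

    open RingSolver coefficients almostRing morphism decide public
      using (solve; con; _:+_; _:*_; _:^_; _:=_)

-- Exponents of theta series

triangle : ℕ → ℕ
triangle zero    = 0
triangle (suc n) = suc n ℕ.+ triangle n

-- j (j + 1) / 2 and j (j - 1) / 2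
triangle⁺ triangle⁻ : ℤ → ℕ
triangle⁺ (+ n)         = triangle n
triangle⁺ -[1+ n ]      = triangle n
triangle⁻ (+ zero)      = 0
triangle⁻ (+ suc n)     = triangle n
triangle⁻ -[1+ n ]      = triangle (suc n)

-- The exponent of the j-th term of Ramanujan's theta function f(X, Y) = ∑ X^{j(j+1)/2} Y^{j(j-1)/2}
-- at X = q^a, Y = q^b.
exponent : ℕ → ℕ → ℤ → ℕ
exponent a b j = a ℕ.* triangle⁺ j ℕ.+ b ℕ.* triangle⁻ j

double-triangle : ∀ n → 2 ℕ.* triangle n ≡ n ℕ.* suc n
double-triangle zero    = refl
double-triangle (suc n) = trans (step n (triangle n)) (trans (cong (2 ℕ.* suc n ℕ.+_) (double-triangle n)) (step′ n))
  where
  step : ∀ n t → 2 ℕ.* (suc n ℕ.+ t) ≡ 2 ℕ.* suc n ℕ.+ 2 ℕ.* t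
  step = ℕRing.solve-∀
  step′ : ∀ n → 2 ℕ.* suc n ℕ.+ n ℕ.* suc n ≡ suc n ℕ.* suc (suc n)
  step′ = ℕRing.solve-∀

private
  double-triangle-ℤ : ∀ n → + 2 ℤ.* + triangle n ≡ + n ℤ.* (+ 1 ℤ.+ + n)
  double-triangle-ℤ n = trans (sym (ℤ.pos-* 2 (triangle n)))
    (trans (cong +_ (double-triangle n)) (ℤ.pos-* n (suc n)))

double-triangle⁺ : ∀ j → + 2 ℤ.* + triangle⁺ j ≡ j ℤ.* (j ℤ.+ + 1)
double-triangle⁺ (+ n)    = trans (double-triangle-ℤ n) (cong (+ n ℤ.*_) (ℤ.+-comm (+ 1) (+ n)))
double-triangle⁺ -[1+ n ] = trans (double-triangle-ℤ n) (ring (+ n))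
  where
  ring : ∀ x → x ℤ.* (+ 1 ℤ.+ x) ≡ ℤ.- (+ 1 ℤ.+ x) ℤ.* (ℤ.- (+ 1 ℤ.+ x) ℤ.+ + 1)
  ring = ℤRing.solve-∀

double-triangle⁻ : ∀ j → + 2 ℤ.* + triangle⁻ j ≡ j ℤ.* (j ℤ.- + 1)
double-triangle⁻ (+ zero)  = refl
double-triangle⁻ (+ suc n) = trans (double-triangle-ℤ n) (ring (+ n))
  where
  ring : ∀ x → x ℤ.* (+ 1 ℤ.+ x) ≡ (+ 1 ℤ.+ x) ℤ.* (+ 1 ℤ.+ x ℤ.- + 1)
  ring = ℤRing.solve-∀
double-triangle⁻ -[1+ n ]  = trans (double-triangle-ℤ (suc n)) (ring (+ n))
  where
  ring : ∀ x → (+ 1 ℤ.+ x) ℤ.* (+ 1 ℤ.+ (+ 1 ℤ.+ x)) ≡ ℤ.- (+ 1 ℤ.+ x) ℤ.* (ℤ.- (+ 1 ℤ.+ x) ℤ.- + 1)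
  ring = ℤRing.solve-∀

-- Doubling clears the halves, so that equalities between exponents become polynomial identities
-- over ℤ.
double-exponent : ∀ a b j →
  + 2 ℤ.* + exponent a b j ≡ + a ℤ.* (j ℤ.* (j ℤ.+ + 1)) ℤ.+ + b ℤ.* (j ℤ.* (j ℤ.- + 1))
double-exponent a b j = trans
  (cong (+ 2 ℤ.*_) (cong₂ ℤ._+_ (ℤ.pos-* a (triangle⁺ j)) (ℤ.pos-* b (triangle⁻ j))))
  (trans (ring (+ a) (+ b) (+ triangle⁺ j) (+ triangle⁻ j))
    (cong₂ ℤ._+_ (cong (+ a ℤ.*_) (double-triangle⁺ j)) (cong (+ b ℤ.*_) (double-triangle⁻ j))))
  where
  ring : ∀ a b x y → + 2 ℤ.* (a ℤ.* x ℤ.+ b ℤ.* y) ≡ a ℤ.* (+ 2 ℤ.* x) ℤ.+ b ℤ.* (+ 2 ℤ.* y)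
  ring = ℤRing.solve-∀

double-injective : ∀ {x y} → + 2 ℤ.* + x ≡ + 2 ℤ.* + y → x ≡ y
double-injective {x} {y} p = ℤ.+-injective (ℤ.*-cancelˡ-≡ (+ 2) (+ x) (+ y) p)

-- This is why a theta series modulo `q^N` needs only finitely many indices.
∣j∣≤exponent : ∀ a b .{{_ : NonZero a}} .{{_ : NonZero b}} j → ∣ j ∣ ≤ exponent a b j
∣j∣≤exponent a b j = ℕ.≤-trans (bound j)
  (ℕ.+-mono-≤ (ℕ.m≤n*m (triangle⁺ j) a) (ℕ.m≤n*m (triangle⁻ j) b))
  where
  n≤triangle : ∀ n → n ≤ triangle n
  n≤triangle zero    = z≤n
  n≤triangle (suc n) = ℕ.m≤m+n (suc n) (triangle n)
  bound : ∀ j → ∣ j ∣ ≤ triangle⁺ j ℕ.+ triangle⁻ j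
  bound (+ n)    = ℕ.≤-trans (n≤triangle n) (ℕ.m≤m+n _ _)
  bound -[1+ n ] = ℕ.≤-trans (n≤triangle (suc n)) (ℕ.m≤n+m _ (triangle n))

suc⊖ : ∀ i n → suc i ⊖ n ≡ ℤ.suc (i ⊖ n)
suc⊖ i n = trans (sym (ℤ.m-n≡m⊖n (suc i) n))
  (trans (ℤ.+-assoc (+ 1) (+ i) (ℤ.- + n)) (cong ℤ.suc (ℤ.m-n≡m⊖n i n)))

exponent-suc : ∀ a b j →
  + exponent a b (ℤ.suc j) ≡ + exponent a b j ℤ.+ (+ a ℤ.+ (+ a ℤ.+ + b) ℤ.* j)
exponent-suc a b j = ℤ.*-cancelˡ-≡ (+ 2) _ _ (begin
  + 2 ℤ.* + exponent a b (ℤ.suc j)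
    ≡⟨ double-exponent a b (ℤ.suc j) ⟩
  + a ℤ.* ((+ 1 ℤ.+ j) ℤ.* (+ 1 ℤ.+ j ℤ.+ + 1)) ℤ.+ + b ℤ.* ((+ 1 ℤ.+ j) ℤ.* (+ 1 ℤ.+ j ℤ.- + 1))
    ≡⟨ ring (+ a) (+ b) j ⟩
  (+ a ℤ.* (j ℤ.* (j ℤ.+ + 1)) ℤ.+ + b ℤ.* (j ℤ.* (j ℤ.- + 1))) ℤ.+ + 2 ℤ.* (+ a ℤ.+ (+ a ℤ.+ + b) ℤ.* j)
    ≡⟨ cong (ℤ._+ + 2 ℤ.* (+ a ℤ.+ (+ a ℤ.+ + b) ℤ.* j)) (sym (double-exponent a b j)) ⟩
  + 2 ℤ.* + exponent a b j ℤ.+ + 2 ℤ.* (+ a ℤ.+ (+ a ℤ.+ + b) ℤ.* j)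
    ≡⟨ ℤ.*-distribˡ-+ (+ 2) (+ exponent a b j) _ ⟨
  + 2 ℤ.* (+ exponent a b j ℤ.+ (+ a ℤ.+ (+ a ℤ.+ + b) ℤ.* j)) ∎)
  where
  open ≡-Reasoning
  ring : ∀ A B j →
    A ℤ.* ((+ 1 ℤ.+ j) ℤ.* (+ 1 ℤ.+ j ℤ.+ + 1)) ℤ.+ B ℤ.* ((+ 1 ℤ.+ j) ℤ.* (+ 1 ℤ.+ j ℤ.- + 1))
    ≡ (A ℤ.* (j ℤ.* (j ℤ.+ + 1)) ℤ.+ B ℤ.* (j ℤ.* (j ℤ.- + 1))) ℤ.+ + 2 ℤ.* (A ℤ.+ (A ℤ.+ B) ℤ.* j)
  ring = ℤRing.solve-∀

module _ (a b : ℕ) where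

  -- The quotients of consecutive terms of the theta series, at j = i - n.
  exponent-⊖-sucˡ : ∀ m n {i i′} → i ℕ.+ i′ ≡ m ℕ.+ n →
    (a ℕ.+ b) ℕ.* i′ ℕ.+ exponent a b (suc i ⊖ n) ≡ (a ℕ.+ (a ℕ.+ b) ℕ.* m) ℕ.+ exponent a b (i ⊖ n)
  exponent-⊖-sucˡ m n {i} {i′} s = ℤ.+-injective (begin
    + ((a ℕ.+ b) ℕ.* i′) ℤ.+ + exponent a b (suc i ⊖ n)
      ≡⟨ cong₂ ℤ._+_ (ℤ.pos-* (a ℕ.+ b) i′)
           (trans (cong (+_ ∘ exponent a b) (suc⊖ i n)) (exponent-suc a b (i ⊖ n))) ⟩
    (+ a ℤ.+ + b) ℤ.* + i′ ℤ.+ (E ℤ.+ (+ a ℤ.+ (+ a ℤ.+ + b) ℤ.* (i ⊖ n)))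
      ≡⟨ cong (λ z → (+ a ℤ.+ + b) ℤ.* + i′ ℤ.+ (E ℤ.+ (+ a ℤ.+ (+ a ℤ.+ + b) ℤ.* z))) (sym (ℤ.m-n≡m⊖n i n)) ⟩
    (+ a ℤ.+ + b) ℤ.* + i′ ℤ.+ (E ℤ.+ (+ a ℤ.+ (+ a ℤ.+ + b) ℤ.* (+ i ℤ.- + n)))
      ≡⟨ ring₁ (+ a) (+ b) E (+ i) (+ i′) (+ n) ⟩
    (+ a ℤ.+ (+ a ℤ.+ + b) ℤ.* (+ (i ℕ.+ i′) ℤ.- + n)) ℤ.+ E
      ≡⟨ cong (λ z → (+ a ℤ.+ (+ a ℤ.+ + b) ℤ.* (+ z ℤ.- + n)) ℤ.+ E) s ⟩
    (+ a ℤ.+ (+ a ℤ.+ + b) ℤ.* (+ m ℤ.+ + n ℤ.- + n)) ℤ.+ E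
      ≡⟨ ring₂ (+ a) (+ b) E (+ m) (+ n) ⟩
    (+ a ℤ.+ (+ a ℤ.+ + b) ℤ.* + m) ℤ.+ E
      ≡⟨ cong (λ z → (+ a ℤ.+ z) ℤ.+ E) (sym (ℤ.pos-* (a ℕ.+ b) m)) ⟩
    + ((a ℕ.+ (a ℕ.+ b) ℕ.* m) ℕ.+ exponent a b (i ⊖ n)) ∎)
    where
    open ≡-Reasoning
    E = + exponent a b (i ⊖ n)
    ring₁ : ∀ A B E I I′ N → (A ℤ.+ B) ℤ.* I′ ℤ.+ (E ℤ.+ (A ℤ.+ (A ℤ.+ B) ℤ.* (I ℤ.- N)))
          ≡ (A ℤ.+ (A ℤ.+ B) ℤ.* (I ℤ.+ I′ ℤ.- N)) ℤ.+ E
    ring₁ = ℤRing.solve-∀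
    ring₂ : ∀ A B E M N → (A ℤ.+ (A ℤ.+ B) ℤ.* (M ℤ.+ N ℤ.- N)) ℤ.+ E
          ≡ (A ℤ.+ (A ℤ.+ B) ℤ.* M) ℤ.+ E
    ring₂ = ℤRing.solve-∀

  exponent-⊖-sucʳ : ∀ i n →
    (a ℕ.+ b) ℕ.* i ℕ.+ exponent a b (i ⊖ suc n) ≡ (b ℕ.+ (a ℕ.+ b) ℕ.* n) ℕ.+ exponent a b (i ⊖ n)
  exponent-⊖-sucʳ i n = ℤ.+-injective (begin
    + ((a ℕ.+ b) ℕ.* i) ℤ.+ E
      ≡⟨ cong (ℤ._+ E) (ℤ.pos-* (a ℕ.+ b) i) ⟩
    (+ a ℤ.+ + b) ℤ.* + i ℤ.+ E
      ≡⟨ ring (+ a) (+ b) E (+ i) (+ n) ⟩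
    (+ b ℤ.+ (+ a ℤ.+ + b) ℤ.* + n) ℤ.+ (E ℤ.+ (+ a ℤ.+ (+ a ℤ.+ + b) ℤ.* (+ i ℤ.- (+ 1 ℤ.+ + n))))
      ≡⟨ cong₂ (λ z w → (+ b ℤ.+ z) ℤ.+ (E ℤ.+ (+ a ℤ.+ (+ a ℤ.+ + b) ℤ.* w)))
           (sym (ℤ.pos-* (a ℕ.+ b) n)) (ℤ.m-n≡m⊖n i (suc n)) ⟩
    + (b ℕ.+ (a ℕ.+ b) ℕ.* n) ℤ.+ (E ℤ.+ (+ a ℤ.+ (+ a ℤ.+ + b) ℤ.* (i ⊖ suc n)))
      ≡⟨ cong (λ z → + (b ℕ.+ (a ℕ.+ b) ℕ.* n) ℤ.+ z) (sym (exponent-suc a b (i ⊖ suc n))) ⟩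
    + (b ℕ.+ (a ℕ.+ b) ℕ.* n) ℤ.+ + exponent a b (ℤ.suc (i ⊖ suc n))
      ≡⟨ cong (λ z → + (b ℕ.+ (a ℕ.+ b) ℕ.* n) ℤ.+ + exponent a b z)
           (trans (sym (suc⊖ i (suc n))) (ℤ.[1+m]⊖[1+n]≡m⊖n i n)) ⟩
    + ((b ℕ.+ (a ℕ.+ b) ℕ.* n) ℕ.+ exponent a b (i ⊖ n)) ∎)
    where
    open ≡-Reasoning
    E = + exponent a b (i ⊖ suc n)
    ring : ∀ A B E I N → (A ℤ.+ B) ℤ.* I ℤ.+ E
         ≡ (B ℤ.+ (A ℤ.+ B) ℤ.* N) ℤ.+ (E ℤ.+ (A ℤ.+ (A ℤ.+ B) ℤ.* (I ℤ.- (+ 1 ℤ.+ N))))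
    ring = ℤRing.solve-∀

-- Decompositions of ℤ²

module ℤGroup = Algebra.Properties.AbelianGroup ℤ.+-0-abelianGroup

residue : ∀ m .{{_ : NonZero m}} → ℤ ↔ (Fin m × ℤ)
residue m = mk↔ₛ′ to from (λ x → injective (from-to (from x))) from-to
  where
  to : ℤ → Fin m × ℤ
  to z = fromℕ< (ℤ.n%ℕd<d z m) , z ℤ./ℕ m

  from : Fin m × ℤ → ℤ
  from (c , k) = + toℕ c ℤ.+ k ℤ.* + m

  from-to : ∀ z → from (to z) ≡ z
  from-to z = trans (cong (λ r → + r ℤ.+ (z ℤ./ℕ m) ℤ.* + m) (Fin.toℕ-fromℕ< (ℤ.n%ℕd<d z m)))
                    (sym (ℤ.a≡a%ℕn+[a/ℕn]*n z m))

  -- (k - l) m is a difference of two residues, hence smaller than m in absolute value, which forces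
  -- k = l.
  quotient-unique : ∀ {c d : Fin m} {k l} → from (c , k) ≡ from (d , l) → k ≡ l
  quotient-unique {c} {d} {k} {l} p = ℤ.i-j≡0⇒i≡j k l (ℤ.∣i∣≡0⇒i≡0 (ℕ.n<1⇒n≡0
    (ℕ.*-cancelʳ-< m ∣ k ℤ.- l ∣ 1 (subst₂ _<_ (ℤ.abs-* (k ℤ.- l) (+ m)) (sym (ℕ.*-identityˡ m)) small))))
    where
    difference : (k ℤ.- l) ℤ.* + m ≡ toℕ d ⊖ toℕ c
    difference = trans (ring₁ k l (+ m) (+ toℕ c)) (trans (cong (ℤ._- (+ toℕ c ℤ.+ l ℤ.* + m)) p)
      (trans (ring₂ l (+ m) (+ toℕ c) (+ toℕ d)) (ℤ.m-n≡m⊖n (toℕ d) (toℕ c))))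
      where
      ring₁ : ∀ k l m c → (k ℤ.- l) ℤ.* m ≡ (c ℤ.+ k ℤ.* m) ℤ.- (c ℤ.+ l ℤ.* m)
      ring₁ = ℤRing.solve-∀
      ring₂ : ∀ l m c d → (d ℤ.+ l ℤ.* m) ℤ.- (c ℤ.+ l ℤ.* m) ≡ d ℤ.- c
      ring₂ = ℤRing.solve-∀
    small : ∣ (k ℤ.- l) ℤ.* + m ∣ < m
    small = subst (_< m) (sym (cong ∣_∣ difference))
      (ℕ.≤-<-trans (ℤ.∣m⊝n∣≤m⊔n (toℕ d) (toℕ c)) (ℕ.⊔-lub (Fin.toℕ<n d) (Fin.toℕ<n c)))

  injective : ∀ {x y} → from x ≡ from y → x ≡ y
  injective {c , k} {d , l} p with refl ← quotient-unique {c} {d} {k} {l} p =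
    cong (_, k) (Fin.toℕ-injective (ℤ.+-injective (ℤGroup.∙-cancelʳ (k ℤ.* + m) (+ toℕ c) (+ toℕ d) p)))

cancel₁ : ∀ x y → x ℤ.- y ℤ.+ y ≡ x
cancel₁ = ℤRing.solve-∀
cancel₂ : ∀ x y → x ℤ.+ y ℤ.- y ≡ x
cancel₂ = ℤRing.solve-∀
cancel₃ : ∀ x y → x ℤ.- (x ℤ.- y) ≡ y
cancel₃ = ℤRing.solve-∀

-- Write a piece as (a , ((b , z) , y)). The Gaussian integer (1 - 3j - k) + (j - 3k) i has real
-- part ≡ 1 + 2b (mod 4) if a = 0; if a = 1, its real part is even and its imaginary part is ≡ 1 +
-- 2b (mod 4). So (a, b) names the unit that makes the real part ≡ 1 (mod 4): 1, -1, -i, i for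
-- (0,0), (0,1), (1,0), (1,1).
Pieces : Set
Pieces = Fin 2 × ((Fin 2 × ℤ) × ℤ)

-- (j , k) is first split by the parity of j + k = 2 w + a.  Then k - w (if a = 0) or w (if a = 1)
-- is split by parity.
evenLattice : (ℤ × ℤ) ↔ Pieces
evenLattice = (↔-id _ ×-↔ (residue 2 ×-↔ ↔-id _)) ↔-∘ (twist ↔-∘ (×-assoc 0ℓ (Fin 2) ℤ ℤ ↔-∘ ((residue 2 ×-↔ ↔-id _) ↔-∘ shear)))
  where
  shear : (ℤ × ℤ) ↔ (ℤ × ℤ)
  shear = mk↔ₛ′ (λ (j , k) → j ℤ.+ k , k) (λ (u , k) → u ℤ.- k , k)
    (λ (u , k) → cong (_, k) (cancel₁ u k)) (λ (j , k) → cong (_, k) (cancel₂ j k))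
  twist : (Fin 2 × (ℤ × ℤ)) ↔ (Fin 2 × (ℤ × ℤ))
  twist = mk↔ₛ′
    (λ { (0F , (w , k)) → 0F , (k ℤ.- w , w) ; (1F , p) → 1F , p })
    (λ { (0F , (x , y)) → 0F , (y , x ℤ.+ y) ; (1F , p) → 1F , p })
    (λ { (0F , (x , y)) → cong (λ z → 0F , (z , y)) (cancel₂ x y) ; (1F , p) → refl })
    (λ { (0F , (w , k)) → cong (λ z → 0F , (w , z)) (cancel₁ k w) ; (1F , p) → refl })

-- Modulo 1 - 2i one has i ≡ 3, so (4s + 1) + 2t i ≡ 1 - (s - t). The class c of s - t modulo 5 is
-- therefore 1 for the multiples of 1 - 2i, and 0, 2, 3, 4 for the residues 1, -1, i, -i. The second
-- shear is chosen so that on the class c = 1 the new coordinates (d , t) are those of the quotient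
-- by 1 - 2i.
fifthLattice : (ℤ × ℤ) ↔ (Fin 5 × (ℤ × ℤ))
fifthLattice = (↔-id _ ×-↔ shear′) ↔-∘ (×-assoc 0ℓ (Fin 5) ℤ ℤ ↔-∘ ((residue 5 ×-↔ ↔-id _) ↔-∘ shear))
  where
  shear : (ℤ × ℤ) ↔ (ℤ × ℤ)
  shear = mk↔ₛ′ (λ (s , t) → s ℤ.- t , s) (λ (u , s) → s , s ℤ.- u)
    (λ (u , s) → cong (_, s) (cancel₃ s u)) (λ (s , t) → cong (s ,_) (cancel₃ s t))
  shear′ : (ℤ × ℤ) ↔ (ℤ × ℤ)
  shear′ = mk↔ₛ′ (λ (d , s) → d , s ℤ.- d) (λ (d , t) → d , t ℤ.+ d)
    (λ (d , t) → cong (d ,_) (cancel₂ t d)) (λ (d , s) → cong (d ,_) (cancel₁ s d))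

-- Each inj₁ case multiplies the Gaussian integer of (j , k) by one of the four units, to make its real part
-- ≡ 1 (mod 4); inj₂ is multiplication by 1 - 2i.
regroup : (Pieces ⊎ (ℤ × ℤ)) ↔ (Fin 5 × (ℤ × ℤ))
regroup = mk↔ₛ′
  (λ { (inj₁ (0F , ((0F , z) , y))) → 0F , (z , ℤ.- y)
     ; (inj₁ (0F , ((1F , z) , y))) → 2F , (ℤ.- z ℤ.- + 1 , y)
     ; (inj₁ (1F , ((0F , z) , y))) → 4F , (ℤ.- z ℤ.- + 1 , + 2 ℤ.* z ℤ.+ + 1 ℤ.- y)
     ; (inj₁ (1F , ((1F , z) , y))) → 3F , (z , y ℤ.- (+ 2 ℤ.* z ℤ.+ + 1))
     ; (inj₂ p)                     → 1F , p })
  (λ { (0F , (d , t)) → inj₁ (0F , ((0F , d) , ℤ.- t))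
     ; (1F , p)       → inj₂ p
     ; (2F , (d , t)) → inj₁ (0F , ((1F , ℤ.- d ℤ.- + 1) , t))
     ; (3F , (d , t)) → inj₁ (1F , ((1F , d) , t ℤ.+ (+ 2 ℤ.* d ℤ.+ + 1)))
     ; (4F , (d , t)) → inj₁ (1F , ((0F , ℤ.- d ℤ.- + 1) , + 2 ℤ.* (ℤ.- d ℤ.- + 1) ℤ.+ + 1 ℤ.- t)) })
  (λ { (0F , (d , t)) → cong (λ z → 0F , (d , z)) (ℤ.neg-involutive t)
     ; (1F , p)       → refl
     ; (2F , (d , t)) → cong (λ z → 2F , (z , t)) (reflect d)
     ; (3F , (d , t)) → cong (λ z → 3F , (d , z)) (cancel₂ t (+ 2 ℤ.* d ℤ.+ + 1))
     ; (4F , (d , t)) → cong₂ (λ z w → 4F , (z , w)) (reflect d) (cancel₃ (+ 2 ℤ.* (ℤ.- d ℤ.- + 1) ℤ.+ + 1) t) })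
  (λ { (inj₁ (0F , ((0F , z) , y))) → cong (λ w → inj₁ (0F , ((0F , z) , w))) (ℤ.neg-involutive y)
     ; (inj₁ (0F , ((1F , z) , y))) → cong (λ w → inj₁ (0F , ((1F , w) , y))) (reflect z)
     ; (inj₁ (1F , ((0F , z) , y))) → cong₂ (λ w v → inj₁ (1F , ((0F , w) , v))) (reflect z)
         (trans (cong (λ w → + 2 ℤ.* w ℤ.+ + 1 ℤ.- (+ 2 ℤ.* z ℤ.+ + 1 ℤ.- y)) (reflect z)) (cancel₃ (+ 2 ℤ.* z ℤ.+ + 1) y))
     ; (inj₁ (1F , ((1F , z) , y))) → cong (λ w → inj₁ (1F , ((1F , z) , w))) (cancel₁ y (+ 2 ℤ.* z ℤ.+ + 1))
     ; (inj₂ p)                     → refl })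
  where
  reflect : ∀ z → ℤ.- (ℤ.- z ℤ.- + 1) ℤ.- + 1 ≡ z
  reflect = ℤRing.solve-∀

-- The left summand stands for the numbers 1 - (3 - i)(j + k i), where 3 - i = (1 + i)(1 - 2i):
-- those of odd norm that are ≡ 1 modulo 1 - 2i. The target has one representative of each class of
-- associates of odd norm, and such a class either consists of multiples of 1 - 2i or has exactly
-- one member ≡ 1 modulo 1 - 2i.
lattice : ((ℤ × ℤ) ⊎ (ℤ × ℤ)) ↔ (ℤ × ℤ)
lattice = ↔-sym fifthLattice ↔-∘ (regroup ↔-∘ (evenLattice ⊎-↔ ↔-id _))

double-exponents : ∀ a b c d i j →
  + 2 ℤ.* + (exponent a b i ℕ.+ exponent c d j)
    ≡ (+ a ℤ.* (i ℤ.* (i ℤ.+ + 1)) ℤ.+ + b ℤ.* (i ℤ.* (i ℤ.- + 1)))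
      ℤ.+ (+ c ℤ.* (j ℤ.* (j ℤ.+ + 1)) ℤ.+ + d ℤ.* (j ℤ.* (j ℤ.- + 1)))
double-exponents a b c d i j = trans (ℤ.*-distribˡ-+ (+ 2) (+ exponent a b i) (+ exponent c d j))
  (cong₂ ℤ._+_ (double-exponent a b i) (double-exponent c d j))

-- e₁ is (∣ (1 - 3j - k) + (j - 3k) i ∣² - 1) / 4, and e₂ is (∣ (4s + 1) + 2t i ∣² - 1) / 4.
e₁ e₂ e₃ : ℤ × ℤ → ℕ
e₁ (j , k) = exponent 1 4 j ℕ.+ exponent 2 3 k
e₂ (s , t) = exponent 6 2 s ℕ.+ exponent 1 1 t
e₃ (s , t) = 1 ℕ.+ (exponent 30 10 s ℕ.+ exponent 5 5 t)

private
  compare : ∀ a b c d a′ b′ c′ d′ i j i′ j′ →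
    (+ a ℤ.* (i ℤ.* (i ℤ.+ + 1)) ℤ.+ + b ℤ.* (i ℤ.* (i ℤ.- + 1)))
      ℤ.+ (+ c ℤ.* (j ℤ.* (j ℤ.+ + 1)) ℤ.+ + d ℤ.* (j ℤ.* (j ℤ.- + 1)))
    ≡ (+ a′ ℤ.* (i′ ℤ.* (i′ ℤ.+ + 1)) ℤ.+ + b′ ℤ.* (i′ ℤ.* (i′ ℤ.- + 1)))
      ℤ.+ (+ c′ ℤ.* (j′ ℤ.* (j′ ℤ.+ + 1)) ℤ.+ + d′ ℤ.* (j′ ℤ.* (j′ ℤ.- + 1))) →
    exponent a b i ℕ.+ exponent c d j ≡ exponent a′ b′ i′ ℕ.+ exponent c′ d′ j′
  compare a b c d a′ b′ c′ d′ i j i′ j′ p = double-injective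
    (trans (double-exponents a b c d i j) (trans p (sym (double-exponents a′ b′ c′ d′ i′ j′))))

module _ where
  open +-*-Solver

  private
    variable
      n : ℕ

    :e : ℕ → ℕ → Polynomial n → Polynomial n
    :e a b i = con (+ a) :* (i :* (i :+ con (+ 1))) :+ con (+ b) :* (i :* (i :- con (+ 1)))

    :residue : ℕ → ℕ → Polynomial n → Polynomial n
    :residue c m z = con (+ c) :+ z :* con (+ m)

    :e₁ :e₂ : Polynomial n → Polynomial n → Polynomial n
    :e₁ j k = :e 1 4 j :+ :e 2 3 k
    :e₂ s t = :e 6 2 s :+ :e 1 1 t

    :even₀ :even₁ : ℕ → Polynomial n → Polynomial n → Polynomial n
    :even₀ b z y = :e₁ (:residue 0 2 y :- (:residue b 2 z :+ y)) (:residue b 2 z :+ y)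
    :even₁ b z y = :e₁ (:residue 1 2 (:residue b 2 z) :- y) y

    :fifth : ℕ → Polynomial n → Polynomial n → Polynomial n
    :fifth c d t = :e₂ (t :+ d) (t :+ d :- :residue c 5 d)

  private
    r : ℕ → ℕ → ℤ → ℤ
    r c m z = + c ℤ.+ z ℤ.* + m

    fifth : ℕ → ℤ → ℤ → ℤ
    fifth c d t = t ℤ.+ d ℤ.- r c 5 d

    -- Units preserve the norm, so each of the four cases is a polynomial identity in z and y.
    e₁-regroup : ∀ p → e₁ (Inverse.from evenLattice p) ≡
      e₂ (Inverse.from fifthLattice (Inverse.to regroup (inj₁ p)))
    e₁-regroup (0F , ((0F , z) , y)) =
      compare 1 4 2 3 6 2 1 1 (r 0 2 y ℤ.- (r 0 2 z ℤ.+ y)) (r 0 2 z ℤ.+ y) (t ℤ.+ z) (fifth 0 z t)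
        (solve 2 (λ z y → :even₀ 0 z y := :fifth 0 z (:- y)) refl z y)
      where t = ℤ.- y
    e₁-regroup (0F , ((1F , z) , y)) =
      compare 1 4 2 3 6 2 1 1 (r 0 2 y ℤ.- (r 1 2 z ℤ.+ y)) (r 1 2 z ℤ.+ y) (y ℤ.+ d) (fifth 2 d y)
        (solve 2 (λ z y → :even₀ 1 z y := :fifth 2 (:- z :- con (+ 1)) y) refl z y)
      where d = ℤ.- z ℤ.- + 1
    e₁-regroup (1F , ((0F , z) , y)) =
      compare 1 4 2 3 6 2 1 1 (r 1 2 (r 0 2 z) ℤ.- y) y (t ℤ.+ d) (fifth 4 d t)
        (solve 2 (λ z y → :even₁ 0 z y := :fifth 4 (:- z :- con (+ 1)) (con (+ 2) :* z :+ con (+ 1) :- y)) refl z y)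
      where
      d = ℤ.- z ℤ.- + 1
      t = + 2 ℤ.* z ℤ.+ + 1 ℤ.- y
    e₁-regroup (1F , ((1F , z) , y)) =
      compare 1 4 2 3 6 2 1 1 (r 1 2 (r 1 2 z) ℤ.- y) y (t ℤ.+ z) (fifth 3 z t)
        (solve 2 (λ z y → :even₁ 1 z y := :fifth 3 z (y :- (con (+ 2) :* z :+ con (+ 1)))) refl z y)
      where t = y ℤ.- (+ 2 ℤ.* z ℤ.+ + 1)

    -- The norm of 1 - 2i is 5: if e is the exponent `e₂` of the quotient, then 5 (4e + 1) = 4 (5e +
    -- 1) + 1.
    e₃-regroup : ∀ p → e₃ p ≡ e₂ (Inverse.from fifthLattice (1F , p))
    e₃-regroup (d , t) = double-injective (trans
      (ℤ.*-distribˡ-+ (+ 2) (+ 1) (+ (exponent 30 10 d ℕ.+ exponent 5 5 t)))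
      (trans (cong (λ z → + 2 ℤ.+ z) (double-exponents 30 10 5 5 d t))
      (trans (solve 2 (λ d t → con (+ 2) :+ (:e 30 10 d :+ :e 5 5 t) := :fifth 1 d t) refl d t)
        (sym (double-exponents 6 2 1 1 (t ℤ.+ d) (fifth 1 d t))))))

  lattice-exponent : ∀ p → [ e₁ , e₃ ] p ≡ e₂ (Inverse.to lattice p)
  lattice-exponent (inj₁ p) = trans (cong e₁ (sym (Inverse.strictlyInverseʳ evenLattice p)))
    (e₁-regroup (Inverse.to evenLattice p))
  lattice-exponent (inj₂ p) = e₃-regroup p

-- Partitions with bounded parts

odd : ℕ → Bool
odd zero    = false
odd (suc n) = not (odd n)

odd-+ : ∀ m n → odd (m ℕ.+ n) ≡ odd m xor odd n
odd-+ zero    n = refl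
odd-+ (suc m) n = trans (cong not (odd-+ m n)) (not-distribˡ-xor (odd m) (odd n))

¬odd⇒even : ∀ n → odd n ≡ false → n % 2 ≡ 0
¬odd⇒even zero          _ = refl
¬odd⇒even (suc (suc n)) p = ¬odd⇒even n (trans (sym (not-involutive (odd n))) p)

-- Lets partitions be counted through membership alone, whatever the order in which they are listed.
length-unique : ∀ {A : Set} {xs ys : List A} → Unique xs → Unique ys →
  (∀ {x} → x ∈ xs → x ∈ ys) → (∀ {x} → x ∈ ys → x ∈ xs) → length xs ≡ length ys
length-unique u v f g = ↭-length (∼bag⇒↭ (unique∧set⇒bag u v (mk⇔ f g)))

module _ (ℓ : ℕ) where

  Bounded : ℕ → List ℕ → Set
  Bounded m p = Regular ℓ p × All (_≤ m) p

  bounded? : ∀ m p → Dec (Bounded m p)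
  bounded? m p = regular? ℓ p ×-dec All.all? (_≤? m) p

  boundedPartitions : ℕ → ℕ → List (List ℕ)
  boundedPartitions m n = filter (bounded? m) (partitions n)

  bounded-unique : ∀ m n → Unique (boundedPartitions m n)
  bounded-unique m n = Unique.filter⁺ (bounded? m) (partitions-unique n)

  ∈-bounded⁻ : ∀ m n {p} → p ∈ boundedPartitions m n → IsPartition n p × Bounded m p
  ∈-bounded⁻ m n p∈ = let q∈ , bd = ∈.∈-filter⁻ (bounded? m) {xs = partitions n} p∈
                       in Equivalence.to (∈-partitions n) q∈ , bd

  ∈-bounded⁺ : ∀ m n {p} → IsPartition n p → Bounded m p → p ∈ boundedPartitions m n
  ∈-bounded⁺ m n ip bd = ∈.∈-filter⁺ (bounded? m) (Equivalence.from (∈-partitions n) ip) bd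

  parts≤sum : ∀ p → All (_≤ sum p) p
  parts≤sum []       = []
  parts≤sum (x ∷ xs) = ℕ.m≤m+n x (sum xs) ∷ All.map (λ l → ℕ.≤-trans l (ℕ.m≤n+m (sum xs) x)) (parts≤sum xs)

  length-bounded-cong : ∀ {m m′ n} →
    (∀ {p} → IsPartition n p → Bounded m p → Bounded m′ p) →
    (∀ {p} → IsPartition n p → Bounded m′ p → Bounded m p) →
    length (boundedPartitions m n) ≡ length (boundedPartitions m′ n)
  length-bounded-cong {m} {m′} {n} f g = length-unique (bounded-unique m n) (bounded-unique m′ n)
    (λ p∈ → let ip , bd = ∈-bounded⁻ m n p∈ in ∈-bounded⁺ m′ n ip (f ip bd))
    (λ p∈ → let ip , bd = ∈-bounded⁻ m′ n p∈ in ∈-bounded⁺ m n ip (g ip bd))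

  weaken : ∀ {m p} → Bounded m p → Bounded (suc m) p
  weaken (r , a) = r , All.map ℕ.m≤n⇒m≤1+n a

  bounded-total : ∀ {m n} → n ≤ m → length (boundedPartitions m n) ≡ length (filter (regular? ℓ) (partitions n))
  bounded-total {m} {n} n≤m = length-unique (bounded-unique m n) (Unique.filter⁺ (regular? ℓ) (partitions-unique n))
    (λ p∈ → let q∈ , r , _ = ∈.∈-filter⁻ (bounded? m) {xs = partitions n} p∈ in ∈.∈-filter⁺ (regular? ℓ) q∈ r)
    (λ {p} p∈ → let q∈ , r = ∈.∈-filter⁻ (regular? ℓ) {xs = partitions n} p∈
                    ip = Equivalence.to (∈-partitions n) q∈
                in ∈-bounded⁺ m n ip (r , All.map (λ l → ℕ.≤-trans l (ℕ.≤-trans (ℕ.≤-reflexive (IsPartition.total ip)) n≤m)) (parts≤sum p)))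

  bounded-small : ∀ {m n} → n ≤ m → length (boundedPartitions (suc m) n) ≡ length (boundedPartitions m n)
  bounded-small n≤m = trans (bounded-total (ℕ.m≤n⇒m≤1+n n≤m)) (sym (bounded-total n≤m))

  bounded-multiple : ∀ m n → ℓ ∣ suc m → length (boundedPartitions (suc m) n) ≡ length (boundedPartitions m n)
  bounded-multiple m n ℓ∣ = length-bounded-cong {suc m} {m} {n}
    (λ _ (r , a) → r , All.zipWith (λ (ℓ∤x , x≤1+m) → ℕ.≤-pred (ℕ.≤∧≢⇒< x≤1+m λ { refl → ℓ∤x ℓ∣ })) (r , a))
    (λ _ → weaken)

  Linked-bound : ∀ {m x p} → Linked _≥_ (x ∷ p) → x ≤ m → All (_≤ m) (x ∷ p)
  Linked-bound [-]       x≤m = x≤m ∷ []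
  Linked-bound (x≥y ∷ l) x≤m = x≤m ∷ Linked-bound l (ℕ.≤-trans x≥y x≤m)

  Linked-cons : ∀ {m p} → All (_≤ m) p → Linked _≥_ p → Linked _≥_ (m ∷ p)
  Linked-cons []      []        = [-]
  Linked-cons (x ∷ _) [-]       = x ∷ [-]
  Linked-cons (x ∷ _) (y ∷ l)   = x ∷ y ∷ l

  Linked-tail : ∀ {x p} → Linked _≥_ (x ∷ p) → Linked _≥_ p
  Linked-tail [-]     = []
  Linked-tail (_ ∷ l) = l

  -- Classify by whether the part m + 1 occurs; if it does, remove one copy of it. The list is
  -- decreasing, so comparing its first part with m decides the case.
  bounded-suc : ∀ m k → ¬ ℓ ∣ suc m → length (boundedPartitions (suc m) (suc m ℕ.+ k)) ≡
    length (boundedPartitions m (suc m ℕ.+ k)) ℕ.+ length (boundedPartitions (suc m) k)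
  bounded-suc m k ℓ∤ = trans
    (length-unique (bounded-unique (suc m) n) unique to from)
    (trans (length-++ (boundedPartitions m n)) (cong (length (boundedPartitions m n) ℕ.+_) (length-map (suc m ∷_) (boundedPartitions (suc m) k))))
    where
    n = suc m ℕ.+ k
    unique : Unique (boundedPartitions m n ++ map (suc m ∷_) (boundedPartitions (suc m) k))
    unique = Unique.++⁺ (bounded-unique m n) (Unique.map⁺ ∷-injectiveʳ (bounded-unique (suc m) k)) disjoint
      where
      disjoint : ∀ {p} → ¬ (p ∈ boundedPartitions m n × p ∈ map (suc m ∷_) (boundedPartitions (suc m) k))
      disjoint (u , v) with ∈.∈-map⁻ (suc m ∷_) v
      ... | _ , _ , refl with ∈-bounded⁻ m n u
      ...   | _ , _ , 1+m≤m ∷ _ = ℕ.<-irrefl refl 1+m≤m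
    to : ∀ {p} → p ∈ boundedPartitions (suc m) n → p ∈ boundedPartitions m n ++ map (suc m ∷_) (boundedPartitions (suc m) k)
    to {p} p∈ with ∈-bounded⁻ (suc m) n p∈
    to {[]}     p∈ | record { total = () } , _
    to {x ∷ xs} p∈ | ip , r@(_ ∷ r′) , x≤1+m ∷ a with x ≤? m
    ... | yes x≤m = ∈.∈-++⁺ˡ (∈-bounded⁺ m n ip (r , Linked-bound (IsPartition.decreasing ip) x≤m))
    ... | no  x≰m with refl ← ℕ.≤-antisym x≤1+m (ℕ.≰⇒> x≰m) =
      ∈.∈-++⁺ʳ (boundedPartitions m n) (∈.∈-map⁺ (suc m ∷_) (∈-bounded⁺ (suc m) k
        (record { positive = All.tail (IsPartition.positive ip) ; decreasing = Linked-tail (IsPartition.decreasing ip)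
                ; total = ℕ.+-cancelˡ-≡ (suc m) (sum xs) k (IsPartition.total ip) })
        (r′ , a)))
    from : ∀ {p} → p ∈ boundedPartitions m n ++ map (suc m ∷_) (boundedPartitions (suc m) k) → p ∈ boundedPartitions (suc m) n
    from {p} p∈ with ∈.∈-++⁻ (boundedPartitions m n) p∈
    ... | inj₁ u = let ip , bd = ∈-bounded⁻ m n u in ∈-bounded⁺ (suc m) n ip (weaken bd)
    ... | inj₂ v with ∈.∈-map⁻ (suc m ∷_) v
    ...   | xs , u , refl = let ip , (r , a) = ∈-bounded⁻ (suc m) k u in ∈-bounded⁺ (suc m) n
            (record { positive = s≤s z≤n ∷ IsPartition.positive ip ; decreasing = Linked-cons a (IsPartition.decreasing ip)
                    ; total = cong (suc m ℕ.+_) (IsPartition.total ip) })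
            (ℓ∤ ∷ r , ℕ.≤-refl ∷ a)

boundedSeries : ℕ → PowerSeries.Series
boundedSeries m n = odd (length (boundedPartitions 5 m n))

-- Theta series modulo q^N

range : ℕ → List ℤ
range n = applyUpTo (_⊖ n) (suc (n ℕ.+ n))

module Modulo (N : ℕ) where
  open PowerSeries
  open Mod N
  open SetoidReasoning setoid

  q^-+ : ∀ m n → (q^ (m ℕ.+ n)) ≈ (q^ m) * (q^ n)
  q^-+ zero    n = ≈-sym (*-identityˡ (q^ n))
  q^-+ (suc m) n = ≈-trans (*-congˡ (q^-+ m n)) (≈-sym (*-assoc q (q^ m) (q^ n)))

  q^-cong : ∀ {m n} → m ≡ n → (q^ m) ≈ (q^ n)
  q^-cong = ≈-reflexive ∘ cong q^_

  q^-* : ∀ m n {k} → m ℕ.+ n ≡ k → (q^ m) * (q^ n) ≈ (q^ k)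
  q^-* m n p = ≈-trans (≈-sym (q^-+ m n)) (q^-cong p)

  q^-vanish : ∀ {e} → N ≤ e → (q^ e) ≈ 0ₛ
  q^-vanish {e} N≤e = agree vanish
    where
    vanish : ∀ n → n < N → (q^ e) n ≡ false
    vanish n n<N with (q^ e) n in p
    ... | false = refl
    ... | true  = contradiction (q^-support e p) (ℕ.>⇒≢ (ℕ.<-≤-trans n<N N≤e))

  -- Units and truncated infinite products

  IsUnit : Series → Set
  IsUnit f = ∃ λ g → f * g ≈ 1ₛ

  unit-1 : IsUnit 1ₛ
  unit-1 = 1ₛ , *-identityˡ 1ₛ

  unit-* : ∀ {f g} → IsUnit f → IsUnit g → IsUnit (f * g)
  unit-* {f} {g} (f′ , p) (g′ , r) = f′ * g′ , (begin
    (f * g) * (f′ * g′)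
      ≈⟨ solve 4 (λ f g f′ g′ → (f :* g) :* (f′ :* g′) := (f :* f′) :* (g :* g′)) ≈-refl f g f′ g′ ⟩
    (f * f′) * (g * g′) ≈⟨ *-cong p r ⟩
    1ₛ * 1ₛ             ≈⟨ *-identityˡ 1ₛ ⟩
    1ₛ                  ∎)

  unit-cancelˡ : ∀ {u f g} → IsUnit u → u * f ≈ u * g → f ≈ g
  unit-cancelˡ {u} {f} {g} (v , p) e = ≈-trans (≈-sym (undo f)) (≈-trans (*-congˡ e) (undo g))
    where
    undo : ∀ h → v * (u * h) ≈ h
    undo h = begin
      v * (u * h) ≈⟨ solve 3 (λ u v h → v :* (u :* h) := (u :* v) :* h) ≈-refl u v h ⟩
      (u * v) * h ≈⟨ *-congʳ p ⟩
      1ₛ * h      ≈⟨ *-identityˡ h ⟩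
      h           ∎

  geometric : ℕ → ℕ → Series
  geometric k zero    = 0ₛ
  geometric k (suc n) = geometric k n + (q^ (k ℕ.* n))

  geometric-sum : ∀ k n → (1ₛ + (q^ k)) * geometric k n ≈ 1ₛ + (q^ (k ℕ.* n))
  geometric-sum k zero = begin
    (1ₛ + (q^ k)) * 0ₛ  ≈⟨ zeroʳ _ ⟩
    0ₛ                  ≈⟨ solve 0 (con true :+ con true := con false) ≈-refl ⟨
    1ₛ + 1ₛ             ≈⟨ +-congˡ (q^-cong (ℕ.*-zeroʳ k)) ⟨
    1ₛ + (q^ (k ℕ.* 0)) ∎
  geometric-sum k (suc n) = begin
    (1ₛ + (q^ k)) * (geometric k n + z)            ≈⟨ distribˡ _ _ z ⟩
    (1ₛ + (q^ k)) * geometric k n + (1ₛ + (q^ k)) * z ≈⟨ +-congʳ (geometric-sum k n) ⟩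
    1ₛ + z + (1ₛ + (q^ k)) * z
      ≈⟨ solve 2 (λ w z → con true :+ z :+ (con true :+ w) :* z := con true :+ w :* z) ≈-refl (q^ k) z ⟩
    1ₛ + (q^ k) * z                                ≈⟨ +-congˡ (q^-* k (k ℕ.* n) (sym (ℕ.*-suc k n))) ⟩
    1ₛ + (q^ (k ℕ.* suc n))                        ∎
    where z = q^ (k ℕ.* n)

  -- The geometric series cut off after N terms is an inverse, since the remainder q^{kN} vanishes
  -- modulo `q^N`.
  unit-1+q^ : ∀ k .{{_ : NonZero k}} → IsUnit (1ₛ + (q^ k))
  unit-1+q^ k = geometric k N , (begin
    (1ₛ + (q^ k)) * geometric k N ≈⟨ geometric-sum k N ⟩
    1ₛ + (q^ (k ℕ.* N))           ≈⟨ +-congˡ (q^-vanish (ℕ.m≤n*m N k)) ⟩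
    1ₛ + 0ₛ                       ≈⟨ +-identityʳ 1ₛ ⟩
    1ₛ                            ∎)

  unit-qProduct : ∀ a .{{_ : NonZero a}} s n → IsUnit (qProduct a s n)
  unit-qProduct a s zero    = unit-1
  unit-qProduct a@(suc _) s (suc n) = unit-* (unit-qProduct a s n) (unit-1+q^ (a ℕ.+ s ℕ.* n))

  -- Beyond the first N factors, each further one is 1 + q^e with e ≥ N, so N factors stand for the
  -- whole infinite product.
  qProduct-stable : ∀ a s .{{_ : NonZero s}} {n} → N ≤ n → qProduct a s n ≈ qProduct a s N
  qProduct-stable a s {n} N≤n =
    ≈-trans (≈-reflexive (cong (qProduct a s) (sym (ℕ.m+[n∸m]≡n N≤n)))) (extend (n ℕ.∸ N))
    where
    extend : ∀ k → qProduct a s (N ℕ.+ k) ≈ qProduct a s N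
    extend zero    = ≈-reflexive (cong (qProduct a s) (ℕ.+-identityʳ N))
    extend (suc k) = begin
      qProduct a s (N ℕ.+ suc k)
        ≡⟨ cong (qProduct a s) (ℕ.+-suc N k) ⟩
      qProduct a s (N ℕ.+ k) * (1ₛ + (q^ (a ℕ.+ s ℕ.* (N ℕ.+ k))))
        ≈⟨ *-cong (extend k) (≈-trans (+-congˡ (q^-vanish large)) (+-identityʳ 1ₛ)) ⟩
      qProduct a s N * 1ₛ
        ≈⟨ *-identityʳ _ ⟩
      qProduct a s N ∎
      where
      large : N ≤ a ℕ.+ s ℕ.* (N ℕ.+ k)
      large = ℕ.≤-trans (ℕ.m≤m+n N k) (ℕ.≤-trans (ℕ.m≤n*m (N ℕ.+ k) s) (ℕ.m≤n+m _ a))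

  -- Gaussian binomial coefficients

  qBinomial-product : ∀ s a b →
    qProduct s s a * qProduct s s b * qBinomial s a b ≈ qProduct s s (a ℕ.+ b)
  qBinomial-product s zero b =
    solve 1 (λ x → con true :* x :* con true := x) ≈-refl (qProduct s s b)
  qBinomial-product s (suc a) zero = ≈-trans
    (solve 1 (λ x → x :* con true :* con true := x) ≈-refl (qProduct s s (suc a)))
    (≈-reflexive (cong (qProduct s s) (sym (ℕ.+-identityʳ (suc a)))))
  qBinomial-product s (suc a) (suc b) = begin
    (A * (1ₛ + (q^ (s ℕ.+ s ℕ.* a)))) * (B * (1ₛ + (q^ (s ℕ.+ s ℕ.* b)))) * (X + (q^ (s ℕ.* suc a)) * Y)
      ≈⟨ *-congʳ (*-congʳ (*-congˡ (+-congˡ (q^-cong (sym (ℕ.*-suc s a)))))) ⟩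
    (A * (1ₛ + x)) * (B * (1ₛ + y)) * (X + x * Y)
      ≈⟨ solve 6 (λ A B x y X Y → (A :* (con true :+ x)) :* (B :* (con true :+ y)) :* (X :+ x :* Y)
           := (con true :+ x) :* (A :* (B :* (con true :+ y)) :* X)
              :+ x :* (con true :+ y) :* ((A :* (con true :+ x)) :* B :* Y)) ≈-refl A B x y X Y ⟩
    (1ₛ + x) * (A * (B * (1ₛ + y)) * X) + x * (1ₛ + y) * ((A * (1ₛ + x)) * B * Y)
      ≈⟨ +-cong (*-congˡ (≈-trans (qBinomial-product s a (suc b))
                   (≈-reflexive (cong (qProduct s s) (ℕ.+-suc a b)))))
                (*-congˡ (≈-trans (*-congʳ (*-congʳ (*-congˡ (+-congˡ (q^-cong (ℕ.*-suc s a))))))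
                   (qBinomial-product s (suc a) b))) ⟩
    -- Pascal's rule rests on (1 + x) + x (1 + y) = 1 + x y in characteristic 2.
    (1ₛ + x) * C + x * (1ₛ + y) * C
      ≈⟨ solve 3 (λ x y C → (con true :+ x) :* C :+ x :* (con true :+ y) :* C
                         := C :* (con true :+ x :* y)) ≈-refl x y C ⟩
    C * (1ₛ + x * y)
      ≈⟨ *-congˡ (+-congˡ (q^-* (s ℕ.* suc a) (s ℕ.+ s ℕ.* b) (exponents s a b))) ⟩
    C * (1ₛ + (q^ (s ℕ.+ s ℕ.* suc (a ℕ.+ b))))
      ≡⟨ cong (qProduct s s ∘ suc) (ℕ.+-suc a b) ⟨
    qProduct s s (suc a ℕ.+ suc b) ∎
    where
    A = qProduct s s a
    B = qProduct s s b
    C = qProduct s s (suc (a ℕ.+ b))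
    X = qBinomial s a (suc b)
    Y = qBinomial s (suc a) b
    x = q^ (s ℕ.* suc a)
    y = q^ (s ℕ.+ s ℕ.* b)
    exponents : ∀ s a b → s ℕ.* suc a ℕ.+ (s ℕ.+ s ℕ.* b) ≡ s ℕ.+ s ℕ.* suc (a ℕ.+ b)
    exponents = ℕRing.solve-∀

  module _ (s : ℕ) .{{_ : NonZero s}} where

    -- The defining recursion is not symmetric, but the product formula is, and its q-products are
    -- units. Symmetry then yields the second form of Pascal's rule.
    qBinomial-sym : ∀ a b → qBinomial s a b ≈ qBinomial s b a
    qBinomial-sym a b = unit-cancelˡ (unit-* (unit-qProduct s s a) (unit-qProduct s s b)) (begin
      qProduct s s a * qProduct s s b * qBinomial s a b ≈⟨ qBinomial-product s a b ⟩
      qProduct s s (a ℕ.+ b)                            ≡⟨ cong (qProduct s s) (ℕ.+-comm a b) ⟩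
      qProduct s s (b ℕ.+ a)                            ≈⟨ qBinomial-product s b a ⟨
      qProduct s s b * qProduct s s a * qBinomial s b a ≈⟨ *-congʳ (*-comm _ _) ⟩
      qProduct s s a * qProduct s s b * qBinomial s b a ∎)

    qBinomial-pascal : ∀ a b →
      qBinomial s (suc a) (suc b) ≈ qBinomial s (suc a) b + (q^ (s ℕ.* suc b)) * qBinomial s a (suc b)
    qBinomial-pascal a b = ≈-trans (qBinomial-sym (suc a) (suc b))
      (+-cong (qBinomial-sym b (suc a)) (*-congˡ (qBinomial-sym (suc b) a)))

  -- Antidiagonal sums and the finite triple product

  antidiagonalSum-cong : ∀ n {g h} → (∀ {i i′} → i ℕ.+ i′ ≡ n → g i i′ ≈ h i i′) →
    antidiagonalSum n g ≈ antidiagonalSum n h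
  antidiagonalSum-cong zero    p = p refl
  antidiagonalSum-cong (suc n) p = +-cong (p refl) (antidiagonalSum-cong n (p ∘ cong suc))

  antidiagonalSum-* : ∀ c n g → antidiagonalSum n (λ i i′ → c * g i i′) ≈ c * antidiagonalSum n g
  antidiagonalSum-* c zero    g = ≈-refl
  antidiagonalSum-* c (suc n) g = ≈-trans (+-congˡ (antidiagonalSum-* c n (g ∘ suc))) (≈-sym (distribˡ c _ _))

  -- The pattern of Pascal's rule: each entry of one antidiagonal receives contributions from its
  -- two neighbours on the previous one, and only one at either end.
  antidiagonalSum-split : ∀ n {h g₁ g₂} →
    (∀ b → h 0 (suc b) ≈ g₁ 0 b) → (∀ a → h (suc a) 0 ≈ g₂ a 0) →
    (∀ a b → h (suc a) (suc b) ≈ g₁ (suc a) b + g₂ a (suc b)) →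
    antidiagonalSum (suc n) h ≈ antidiagonalSum n g₁ + antidiagonalSum n g₂
  antidiagonalSum-split zero    p r s = +-cong (p 0) (r 0)
  antidiagonalSum-split (suc n) {h} {g₁} {g₂} p r s = begin
    h 0 (2 ℕ.+ n) + (h 1 (suc n) + antidiagonalSum n (h ∘ suc ∘ suc))
      ≈⟨ +-cong (p (suc n)) (antidiagonalSum-split′ n) ⟩
    g₁ 0 (suc n) + (g₂ 0 (suc n) + antidiagonalSum n (g₁ ∘ suc) + antidiagonalSum n (g₂ ∘ suc))
      ≈⟨ solve 4 (λ a b c d → a :+ (b :+ c :+ d) := (a :+ c) :+ (b :+ d)) ≈-refl
           (g₁ 0 (suc n)) (g₂ 0 (suc n)) (antidiagonalSum n (g₁ ∘ suc)) (antidiagonalSum n (g₂ ∘ suc)) ⟩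
    antidiagonalSum (suc n) g₁ + antidiagonalSum (suc n) g₂ ∎
    where
    -- Once the entry in row 0 is removed, the contribution of `g₂ 0` is left over at the new
    -- boundary. `k₁` absorbs it there, so that the induction hypothesis applies to the shifted sum.
    k₁ : ℕ → ℕ → Series
    k₁ zero    b = g₂ 0 (suc b) + g₁ 1 b
    k₁ (suc a) b = g₁ (2 ℕ.+ a) b
    first : ∀ n → antidiagonalSum n k₁ ≈ g₂ 0 (suc n) + antidiagonalSum n (g₁ ∘ suc)
    first zero    = ≈-refl
    first (suc n) = +-assoc _ _ _
    antidiagonalSum-split′ : ∀ n → antidiagonalSum (suc n) (h ∘ suc)
      ≈ g₂ 0 (suc n) + antidiagonalSum n (g₁ ∘ suc) + antidiagonalSum n (g₂ ∘ suc)
    antidiagonalSum-split′ n = ≈-trans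
      (antidiagonalSum-split n {h ∘ suc} {k₁} {g₂ ∘ suc}
        (λ b → ≈-trans (s 0 b) (+-comm _ _)) (r ∘ suc) (s ∘ suc))
      (+-congʳ (first n))

  module _ (a b : ℕ) .{{_ : NonZero a}} .{{_ : NonZero b}} where

    private
      s : ℕ
      s = a ℕ.+ b
      instance
        s≢0 : NonZero s
        s≢0 = ℕ.>-nonZero (ℕ.≤-trans (ℕ.>-nonZero⁻¹ a) (ℕ.m≤m+n a b))

      term : ℕ → ℕ → Series
      term n i = q^ exponent a b (i ⊖ n)

      summand : ℕ → ℕ → ℕ → Series
      summand n i i′ = qBinomial s i i′ * term n i

    -- The finite triple product: ∏_{k<m} (1 + X Q^k) ∏_{k<n} (1 + Y Q^k) with X = q^a, Y = q^b, Q = X Y.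
    finite-triple-product : ∀ m n →
      qProduct a s m * qProduct b s n ≈ antidiagonalSum (m ℕ.+ n) (summand n)
    finite-triple-product zero zero = ≈-trans (*-identityˡ 1ₛ)
      (≈-sym (≈-trans (*-identityˡ _) (q^-cong (cong₂ ℕ._+_ (ℕ.*-zeroʳ a) (ℕ.*-zeroʳ b)))))
    finite-triple-product (suc m) n = begin
      qProduct a s m * (1ₛ + x) * qProduct b s n
        ≈⟨ solve 3 (λ A B x → A :* (con true :+ x) :* B := A :* B :+ x :* (A :* B)) ≈-refl
             (qProduct a s m) (qProduct b s n) x ⟩
      qProduct a s m * qProduct b s n + x * (qProduct a s m * qProduct b s n)
        ≈⟨ +-cong IH (≈-trans (*-congˡ IH) (≈-sym (antidiagonalSum-* x (m ℕ.+ n) (summand n)))) ⟩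
      antidiagonalSum (m ℕ.+ n) (summand n) + antidiagonalSum (m ℕ.+ n) (λ i i′ → x * summand n i i′)
        -- Multiplication by the new factor q^{a + s m} moves the index from i to i + 1 at the cost
        -- of q^{s i′}, because i + i′ = m + n. This is the weight in the second form of Pascal's
        -- rule.
        ≈⟨ +-congˡ (antidiagonalSum-cong (m ℕ.+ n) λ {i} {i′} p → begin
             x * (qBinomial s i i′ * term n i)
               ≈⟨ solve 3 (λ x B t → x :* (B :* t) := B :* (x :* t)) ≈-refl x (qBinomial s i i′) (term n i) ⟩
             qBinomial s i i′ * (x * term n i)
               ≈⟨ *-congˡ (≈-trans (≈-sym (q^-+ (a ℕ.+ s ℕ.* m) _)) (≈-trans (q^-cong (sym (exponent-⊖-sucˡ a b m n p))) (q^-+ (s ℕ.* i′) _))) ⟩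
             qBinomial s i i′ * ((q^ (s ℕ.* i′)) * term n (suc i)) ∎) ⟩
      antidiagonalSum (m ℕ.+ n) (summand n)
        + antidiagonalSum (m ℕ.+ n) (λ i i′ → qBinomial s i i′ * ((q^ (s ℕ.* i′)) * term n (suc i)))
        ≈⟨ antidiagonalSum-split (m ℕ.+ n) {summand n}
             (λ _ → ≈-refl) boundary
             (λ i i′ → ≈-trans (*-congʳ (qBinomial-pascal s i i′))
               (solve 4 (λ A B x t → (A :+ x :* B) :* t := A :* t :+ B :* (x :* t)) ≈-refl
                 (qBinomial s (suc i) i′) (qBinomial s i (suc i′)) (q^ (s ℕ.* suc i′)) (term n (suc i)))) ⟨
      antidiagonalSum (suc m ℕ.+ n) (summand n) ∎
      where
      x = q^ (a ℕ.+ s ℕ.* m)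
      IH = finite-triple-product m n
      boundary : ∀ i → summand n (suc i) 0 ≈ qBinomial s i 0 * ((q^ (s ℕ.* 0)) * term n (suc i))
      boundary i = ≈-trans (*-cong (≈-reflexive (qBinomial-zeroʳ i))
        (≈-trans (≈-sym (*-identityˡ _)) (*-congʳ (q^-cong (sym (ℕ.*-zeroʳ s)))))) ≈-refl
        where
        qBinomial-zeroʳ : ∀ i → 1ₛ ≡ qBinomial s i 0
        qBinomial-zeroʳ zero    = refl
        qBinomial-zeroʳ (suc _) = refl
    finite-triple-product zero (suc n) = begin
      1ₛ * (qProduct b s n * (1ₛ + y))
        ≈⟨ solve 2 (λ B y → con true :* (B :* (con true :+ y)) := y :* (con true :* B) :+ con true :* B) ≈-refl
             (qProduct b s n) y ⟩
      y * (1ₛ * qProduct b s n) + 1ₛ * qProduct b s n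
        ≈⟨ +-cong (≈-trans (*-congˡ IH) (≈-sym (antidiagonalSum-* y n (summand n)))) IH ⟩
      antidiagonalSum n (λ i i′ → y * summand n i i′) + antidiagonalSum n (summand n)
        ≈⟨ +-cong (antidiagonalSum-cong n λ {i} {i′} _ → begin
             y * (qBinomial s i i′ * term n i)
               ≈⟨ solve 3 (λ x B t → x :* (B :* t) := B :* (x :* t)) ≈-refl y (qBinomial s i i′) (term n i) ⟩
             qBinomial s i i′ * (y * term n i)
               ≈⟨ *-congˡ (≈-trans (≈-sym (q^-+ (b ℕ.+ s ℕ.* n) _)) (≈-trans (q^-cong (sym (exponent-⊖-sucʳ a b i n))) (q^-+ (s ℕ.* i) _))) ⟩
             qBinomial s i i′ * ((q^ (s ℕ.* i)) * term (suc n) i) ∎)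
             -- The theta index i - n is unchanged when i and n both grow by one, so here it is the
             -- other sum, the one without y, whose i moves.
             (antidiagonalSum-cong n λ {i} {i′} _ →
               *-congˡ (q^-cong (cong (exponent a b) (sym (ℤ.[1+m]⊖[1+n]≡m⊖n i n))))) ⟩
      antidiagonalSum n (λ i i′ → qBinomial s i i′ * ((q^ (s ℕ.* i)) * term (suc n) i))
        + antidiagonalSum n (λ i i′ → qBinomial s i i′ * term (suc n) (suc i))
        ≈⟨ antidiagonalSum-split n {summand (suc n)}
             (λ _ → *-congˡ (≈-trans (≈-sym (*-identityˡ _)) (*-congʳ (q^-cong (sym (ℕ.*-zeroʳ s))))))
             boundary
             (λ i i′ → solve 4 (λ A B x t → (A :+ x :* B) :* t := B :* (x :* t) :+ A :* t) ≈-refl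
                 (qBinomial s i (suc i′)) (qBinomial s (suc i) i′) (q^ (s ℕ.* suc i)) (term (suc n) (suc i))) ⟨
      antidiagonalSum (suc n) (summand (suc n)) ∎
      where
      y = q^ (b ℕ.+ s ℕ.* n)
      IH = finite-triple-product zero n
      boundary : ∀ i → summand (suc n) (suc i) 0 ≈ qBinomial s i 0 * term (suc n) (suc i)
      boundary zero    = ≈-refl
      boundary (suc _) = ≈-refl

  -- The triple product modulo q^N

  P : ℕ → ℕ → Series
  P a s = qProduct a s N

  antidiagonalSum-Θ : {I : Set} (e : I → ℕ) (f : ℕ → I) (n : ℕ) →
    antidiagonalSum n (λ i _ → q^ e (f i)) ≈ Θ e (applyUpTo f (suc n))
  antidiagonalSum-Θ e f zero    = ≈-sym (+-identityʳ _)
  antidiagonalSum-Θ e f (suc n) = +-congˡ (antidiagonalSum-Θ e (f ∘ suc) n)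

  module _ (a b : ℕ) .{{_ : NonZero a}} .{{_ : NonZero b}} where

    -- The window from -2N to 2N is twice as wide as the exponents require. The margin makes the
    -- binomial coefficients stabilise at every index that contributes.
    θ : Series
    θ = Θ (exponent a b) (range (N ℕ.+ N))

    private
      s : ℕ
      s = a ℕ.+ b
      instance
        s≢0 : NonZero s
        s≢0 = ℕ.>-nonZero (ℕ.≤-trans (ℕ.>-nonZero⁻¹ a) (ℕ.m≤m+n a b))

    -- If i and i′ are both at least N, the three q-products in the product formula have stabilised,
    -- and the binomial coefficient is the inverse of `P s s`. Otherwise the theta index i - 2N has
    -- absolute value at least N, and the term vanishes.
    term-limit : ∀ {i i′} → i ℕ.+ i′ ≡ (N ℕ.+ N) ℕ.+ (N ℕ.+ N) →
      P s s * (qBinomial s i i′ * (q^ exponent a b (i ⊖ (N ℕ.+ N)))) ≈ (q^ exponent a b (i ⊖ (N ℕ.+ N)))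
    term-limit {i} {i′} sum = cases (N ℕ.≤? i) (N ℕ.≤? i′)
      where
      U = P s s
      t = q^ exponent a b (i ⊖ (N ℕ.+ N))

      vanish : N ≤ ∣ i ⊖ (N ℕ.+ N) ∣ → U * (qBinomial s i i′ * t) ≈ t
      vanish far = begin
        U * (qBinomial s i i′ * t)  ≈⟨ *-congˡ (*-congˡ t≈0) ⟩
        U * (qBinomial s i i′ * 0ₛ) ≈⟨ solve 2 (λ x y → x :* (y :* con false) := con false) ≈-refl U (qBinomial s i i′) ⟩
        0ₛ                          ≈⟨ t≈0 ⟨
        t                           ∎
        where
        t≈0 : t ≈ 0ₛ
        t≈0 = q^-vanish (ℕ.≤-trans far (∣j∣≤exponent a b (i ⊖ (N ℕ.+ N))))

      cases : Dec (N ≤ i) → Dec (N ≤ i′) → U * (qBinomial s i i′ * t) ≈ t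
      cases (no N≰i) _ = vanish (ℕ.≤-trans (ℕ.m+n≤o⇒m≤o∸n N (ℕ.+-monoʳ-≤ N i≤N))
        (ℕ.≤-reflexive (sym (ℤ.∣⊖∣-≤ (ℕ.≤-trans i≤N (ℕ.m≤m+n N N))))))
        where i≤N = ℕ.≰⇒≥ N≰i
      cases (yes _) (no N≰i′) = vanish (ℕ.≤-trans (ℕ.m+n≤o⇒m≤o∸n N 3N≤i)
        (ℕ.≤-reflexive (sym (cong ∣_∣ (ℤ.⊖-≥ (ℕ.m+n≤o⇒n≤o N 3N≤i))))))
        where
        3N≤i : N ℕ.+ (N ℕ.+ N) ≤ i
        3N≤i = ℕ.+-cancelʳ-≤ N (N ℕ.+ (N ℕ.+ N)) i (ℕ.≤-trans
          (ℕ.≤-reflexive (trans (rearrange N) (sym sum))) (ℕ.+-monoʳ-≤ i (ℕ.≰⇒≥ N≰i′)))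
          where
          rearrange : ∀ n → (n ℕ.+ (n ℕ.+ n)) ℕ.+ n ≡ (n ℕ.+ n) ℕ.+ (n ℕ.+ n)
          rearrange = ℕRing.solve-∀
      cases (yes N≤i) (yes N≤i′) = begin
        U * (qBinomial s i i′ * t) ≈⟨ *-assoc U _ t ⟨
        U * qBinomial s i i′ * t   ≈⟨ *-congʳ (unit-cancelˡ (unit-qProduct s s N) UUB) ⟩
        1ₛ * t                     ≈⟨ *-identityˡ t ⟩
        t                          ∎
        where
        UUB : U * (U * qBinomial s i i′) ≈ U * 1ₛ
        UUB = begin
          U * (U * qBinomial s i i′)
            ≈⟨ *-assoc U U _ ⟨
          U * U * qBinomial s i i′
            ≈⟨ *-congʳ (*-cong (qProduct-stable s s N≤i) (qProduct-stable s s N≤i′)) ⟨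
          qProduct s s i * qProduct s s i′ * qBinomial s i i′
            ≈⟨ qBinomial-product s i i′ ⟩
          qProduct s s (i ℕ.+ i′)
            ≈⟨ qProduct-stable s s (ℕ.≤-trans N≤i (ℕ.m≤m+n i i′)) ⟩
          U
            ≈⟨ *-identityʳ U ⟨
          U * 1ₛ ∎

    triple-product : θ ≈ P a s * P b s * P s s
    triple-product = begin
      θ ≈⟨ antidiagonalSum-Θ (exponent a b) (_⊖ n) (n ℕ.+ n) ⟨
      antidiagonalSum (n ℕ.+ n) (λ i _ → q^ exponent a b (i ⊖ n))
        ≈⟨ antidiagonalSum-cong (n ℕ.+ n) term-limit ⟨
      antidiagonalSum (n ℕ.+ n) (λ i i′ → P s s * (qBinomial s i i′ * (q^ exponent a b (i ⊖ n))))
        ≈⟨ antidiagonalSum-* (P s s) (n ℕ.+ n) _ ⟩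
      P s s * antidiagonalSum (n ℕ.+ n) (λ i i′ → qBinomial s i i′ * (q^ exponent a b (i ⊖ n)))
        ≈⟨ *-congˡ (finite-triple-product a b n n) ⟨
      P s s * (qProduct a s n * qProduct b s n)
        ≈⟨ *-congˡ (*-cong (qProduct-stable a s N≤n) (qProduct-stable b s N≤n)) ⟩
      P s s * (P a s * P b s)
        ≈⟨ *-comm _ _ ⟩
      P a s * P b s * P s s ∎
      where
      n = N ℕ.+ N
      N≤n = ℕ.m≤m+n N N

  -- Product formulas for the theta series that occur

  ∏<-cong : ∀ r {f g} → (∀ i → f i ≈ g i) → ∏< r f ≈ ∏< r g
  ∏<-cong zero    p = ≈-refl
  ∏<-cong (suc r) p = *-cong (∏<-cong r p) (p r)

  ∏<-* : ∀ r f g → ∏< r f * ∏< r g ≈ ∏< r (λ i → f i * g i)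
  ∏<-* zero    f g = *-identityˡ 1ₛ
  ∏<-* (suc r) f g = ≈-trans
    (solve 4 (λ a b c d → (a :* b) :* (c :* d) := (a :* c) :* (b :* d)) ≈-refl (∏< r f) (f r) (∏< r g) (g r))
    (*-congʳ (∏<-* r f g))

  ∏<-1 : ∀ r → ∏< r (λ _ → 1ₛ) ≈ 1ₛ
  ∏<-1 zero    = ≈-refl
  ∏<-1 (suc r) = ≈-trans (*-identityʳ _) (∏<-1 r)

  qProduct-+ : ∀ a s m r →
    qProduct a s (r ℕ.+ m) ≈ qProduct a s m * ∏< r (λ i → 1ₛ + (q^ (a ℕ.+ s ℕ.* (i ℕ.+ m))))
  qProduct-+ a s m zero    = ≈-sym (*-identityʳ _)
  qProduct-+ a s m (suc r) = ≈-trans (*-congʳ (qProduct-+ a s m r)) (*-assoc _ _ _)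

  qProduct-residues : ∀ a s r n →
    qProduct a s (n ℕ.* r) ≈ ∏< r (λ i → qProduct (a ℕ.+ s ℕ.* i) (s ℕ.* r) n)
  qProduct-residues a s r zero    = ≈-sym (∏<-1 r)
  qProduct-residues a s r (suc n) = begin
    qProduct a s (r ℕ.+ n ℕ.* r)
      ≈⟨ qProduct-+ a s (n ℕ.* r) r ⟩
    qProduct a s (n ℕ.* r) * ∏< r (λ i → 1ₛ + (q^ (a ℕ.+ s ℕ.* (i ℕ.+ n ℕ.* r))))
      ≈⟨ *-cong (qProduct-residues a s r n) (∏<-cong r (λ i → +-congˡ (q^-cong (rearrange a s r n i)))) ⟩
    ∏< r (λ i → qProduct (a ℕ.+ s ℕ.* i) (s ℕ.* r) n) * ∏< r (λ i → 1ₛ + (q^ (a ℕ.+ s ℕ.* i ℕ.+ s ℕ.* r ℕ.* n)))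
      ≈⟨ ∏<-* r _ _ ⟩
    ∏< r (λ i → qProduct (a ℕ.+ s ℕ.* i) (s ℕ.* r) (suc n)) ∎
    where
    rearrange : ∀ a s r n i → a ℕ.+ s ℕ.* (i ℕ.+ n ℕ.* r) ≡ a ℕ.+ s ℕ.* i ℕ.+ s ℕ.* r ℕ.* n
    rearrange = ℕRing.solve-∀

  -- The factors are grouped by their index modulo r. Taking N factors from each class means taking
  -- the first N r altogether, which by stability is the same product.
  P-residues : ∀ a s .{{_ : NonZero s}} r .{{_ : NonZero r}} →
    P a s ≈ ∏< r (λ i → P (a ℕ.+ s ℕ.* i) (s ℕ.* r))
  P-residues a s r = ≈-trans (≈-sym (qProduct-stable a s (ℕ.m≤m*n N r))) (qProduct-residues a s r N)

  qProduct-square : ∀ a s n → qProduct a s n * qProduct a s n ≈ qProduct (a ℕ.+ a) (s ℕ.+ s) n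
  qProduct-square a s zero    = *-identityˡ 1ₛ
  qProduct-square a s (suc n) = begin
    A * (1ₛ + x) * (A * (1ₛ + x))
      ≈⟨ solve 2 (λ A x → A :* (con true :+ x) :* (A :* (con true :+ x)) := A :* A :* (con true :+ x :* x)) ≈-refl A x ⟩
    A * A * (1ₛ + x * x)
      ≈⟨ *-cong (qProduct-square a s n) (+-congˡ (q^-* e e (rearrange a s n))) ⟩
    qProduct (a ℕ.+ a) (s ℕ.+ s) (suc n) ∎
    where
    A = qProduct a s n
    e = a ℕ.+ s ℕ.* n
    x = q^ e
    rearrange : ∀ a s n → (a ℕ.+ s ℕ.* n) ℕ.+ (a ℕ.+ s ℕ.* n) ≡ a ℕ.+ a ℕ.+ (s ℕ.+ s) ℕ.* n
    rearrange = ℕRing.solve-∀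

  F : ℕ → Series
  F k = P k k

  F-square : ∀ k → F k * F k ≈ F (k ℕ.+ k)
  F-square k = qProduct-square k k N

  module _ (c : ℕ) .{{_ : NonZero c}} where

    private
      instance
        2c≢0 : NonZero (c ℕ.+ c)
        2c≢0 = ℕ.>-nonZero (ℕ.≤-trans (ℕ.>-nonZero⁻¹ c) (ℕ.m≤m+n c c))
        3c≢0 : NonZero (c ℕ.+ c ℕ.+ c)
        3c≢0 = ℕ.>-nonZero (ℕ.≤-trans (ℕ.>-nonZero⁻¹ c) (ℕ.m≤n+m c (c ℕ.+ c)))

      P-cong : ∀ {a a′ s s′} → a ≡ a′ → s ≡ s′ → P a s ≈ P a′ s′
      P-cong p r = ≈-reflexive (cong₂ P p r)

      x : Series
      x = F c

    -- Euler's pentagonal number theorem: the three factors of the triple product are the classes c,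
    -- 2c and 3c modulo 3c.
    θ-pentagonal : θ (c ℕ.+ c) c ≈ F c
    θ-pentagonal = begin
      θ (c ℕ.+ c) c
        ≈⟨ triple-product (c ℕ.+ c) c ⟩
      P (c ℕ.+ c) s * P c s * P s s
        ≈⟨ *-cong (*-cong (P-cong (eq₁ c) (eq₃ c)) (P-cong (eq₀ c) (eq₃ c))) (P-cong (eq₂ c) (eq₃ c)) ⟩
      P (c ℕ.+ c ℕ.* 1) (c ℕ.* 3) * P (c ℕ.+ c ℕ.* 0) (c ℕ.* 3) * P (c ℕ.+ c ℕ.* 2) (c ℕ.* 3)
        ≈⟨ solve 3 (λ a b d → b :* a :* d := con true :* a :* b :* d) ≈-refl
             (P (c ℕ.+ c ℕ.* 0) (c ℕ.* 3)) (P (c ℕ.+ c ℕ.* 1) (c ℕ.* 3)) (P (c ℕ.+ c ℕ.* 2) (c ℕ.* 3)) ⟩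
      ∏< 3 (λ i → P (c ℕ.+ c ℕ.* i) (c ℕ.* 3))
        ≈⟨ P-residues c c 3 ⟨
      F c ∎
      where
      s = c ℕ.+ c ℕ.+ c
      eq₀ : ∀ c → c ≡ c ℕ.+ c ℕ.* 0
      eq₀ = ℕRing.solve-∀
      eq₁ : ∀ c → c ℕ.+ c ≡ c ℕ.+ c ℕ.* 1
      eq₁ = ℕRing.solve-∀
      eq₂ : ∀ c → c ℕ.+ c ℕ.+ c ≡ c ℕ.+ c ℕ.* 2
      eq₂ = ℕRing.solve-∀
      eq₃ : ∀ c → c ℕ.+ c ℕ.+ c ≡ c ℕ.* 3
      eq₃ = ℕRing.solve-∀

    -- The exponents are c t², and the terms at t and -t cancel. In terms of products, f_{2c} times
    -- the series is the square of f_c, which is f_{2c} by Frobenius.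
    θ-squares : θ c c ≈ 1ₛ
    θ-squares = unit-cancelˡ (unit-qProduct (c ℕ.+ c) (c ℕ.+ c) N) (begin
      F (c ℕ.+ c) * θ c c
        ≈⟨ *-congˡ (triple-product c c) ⟩
      F (c ℕ.+ c) * (P c (c ℕ.+ c) * P c (c ℕ.+ c) * F (c ℕ.+ c))
        ≈⟨ solve 2 (λ a b → b :* (a :* a :* b) := (con true :* a :* b) :* (con true :* a :* b)) ≈-refl
             (P c (c ℕ.+ c)) (F (c ℕ.+ c)) ⟩
      (1ₛ * P c (c ℕ.+ c) * F (c ℕ.+ c)) * (1ₛ * P c (c ℕ.+ c) * F (c ℕ.+ c))
        ≈⟨ *-cong split split ⟨
      x * x
        ≈⟨ F-square c ⟩
      F (c ℕ.+ c)
        ≈⟨ *-identityʳ _ ⟨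
      F (c ℕ.+ c) * 1ₛ ∎)
      where
      split : x ≈ 1ₛ * P c (c ℕ.+ c) * F (c ℕ.+ c)
      split = ≈-trans (P-residues c c 2)
        (*-cong (*-congˡ (P-cong (eq₀ c) (eq₂ c))) (P-cong (eq₁ c) (eq₂ c)))
        where
        eq₀ : ∀ c → c ℕ.+ c ℕ.* 0 ≡ c
        eq₀ = ℕRing.solve-∀
        eq₁ : ∀ c → c ℕ.+ c ℕ.* 1 ≡ c ℕ.+ c
        eq₁ = ℕRing.solve-∀
        eq₂ : ∀ c → c ℕ.* 2 ≡ c ℕ.+ c
        eq₂ = ℕRing.solve-∀

    -- Jacobi's identity for the cube, modulo 2: the exponents c j (2j + 1) run once through c times
    -- the triangular numbers. Multiplying by f_{2c} completes the classes modulo 4c to f_c, with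
    -- one extra factor f_{4c} = f_c⁴.
    θ-triangular : θ (c ℕ.+ c ℕ.+ c) c ≈ x * x * x
    θ-triangular = unit-cancelˡ (unit-qProduct (c ℕ.+ c) (c ℕ.+ c) N) (begin
      F (c ℕ.+ c) * θ (c ℕ.+ c ℕ.+ c) c
        ≈⟨ *-cong split₂ (triple-product (c ℕ.+ c ℕ.+ c) c) ⟩
      1ₛ * P₂ * P₄ * (P₃ * P₁ * P₄)
        ≈⟨ solve 4 (λ a b d e → con true :* b :* e :* (d :* a :* e) := con true :* a :* b :* d :* e :* e) ≈-refl P₁ P₂ P₃ P₄ ⟩
      1ₛ * P₁ * P₂ * P₃ * P₄ * P₄
        ≈⟨ *-cong (≈-sym split₁) P₄≈ ⟩
      x * (x * x * (x * x))
        ≈⟨ solve 1 (λ x → x :* (x :* x :* (x :* x)) := x :* x :* (x :* x :* x)) ≈-refl x ⟩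
      x * x * (x * x * x)
        ≈⟨ *-congʳ (F-square c) ⟩
      F (c ℕ.+ c) * (x * x * x) ∎)
      where
      s = c ℕ.+ c ℕ.+ c ℕ.+ c
      P₁ = P c s
      P₂ = P (c ℕ.+ c) s
      P₃ = P (c ℕ.+ c ℕ.+ c) s
      P₄ = P s s
      split₁ : x ≈ 1ₛ * P₁ * P₂ * P₃ * P₄
      split₁ = ≈-trans (P-residues c c 4)
        (*-cong (*-cong (*-cong (*-congˡ (P-cong (eq₀ c) (eq₄ c))) (P-cong (eq₁ c) (eq₄ c)))
          (P-cong (eq₂ c) (eq₄ c))) (P-cong (eq₃ c) (eq₄ c)))
        where
        eq₀ : ∀ c → c ℕ.+ c ℕ.* 0 ≡ c
        eq₀ = ℕRing.solve-∀
        eq₁ : ∀ c → c ℕ.+ c ℕ.* 1 ≡ c ℕ.+ c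
        eq₁ = ℕRing.solve-∀
        eq₂ : ∀ c → c ℕ.+ c ℕ.* 2 ≡ c ℕ.+ c ℕ.+ c
        eq₂ = ℕRing.solve-∀
        eq₃ : ∀ c → c ℕ.+ c ℕ.* 3 ≡ c ℕ.+ c ℕ.+ c ℕ.+ c
        eq₃ = ℕRing.solve-∀
        eq₄ : ∀ c → c ℕ.* 4 ≡ c ℕ.+ c ℕ.+ c ℕ.+ c
        eq₄ = ℕRing.solve-∀
      split₂ : F (c ℕ.+ c) ≈ 1ₛ * P₂ * P₄
      split₂ = ≈-trans (P-residues (c ℕ.+ c) (c ℕ.+ c) 2)
        (*-cong (*-congˡ (P-cong (eq₀ c) (eq₂ c))) (P-cong (eq₁ c) (eq₂ c)))
        where
        eq₀ : ∀ c → (c ℕ.+ c) ℕ.+ (c ℕ.+ c) ℕ.* 0 ≡ c ℕ.+ c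
        eq₀ = ℕRing.solve-∀
        eq₁ : ∀ c → (c ℕ.+ c) ℕ.+ (c ℕ.+ c) ℕ.* 1 ≡ c ℕ.+ c ℕ.+ c ℕ.+ c
        eq₁ = ℕRing.solve-∀
        eq₂ : ∀ c → (c ℕ.+ c) ℕ.* 2 ≡ c ℕ.+ c ℕ.+ c ℕ.+ c
        eq₂ = ℕRing.solve-∀
      P₄≈ : P₄ ≈ x * x * (x * x)
      P₄≈ = ≈-sym (begin
        x * x * (x * x)             ≈⟨ *-cong (F-square c) (F-square c) ⟩
        F (c ℕ.+ c) * F (c ℕ.+ c)   ≈⟨ F-square (c ℕ.+ c) ⟩
        F (c ℕ.+ c ℕ.+ (c ℕ.+ c))   ≈⟨ P-cong (ℕ.+-assoc (c ℕ.+ c) c c) (ℕ.+-assoc (c ℕ.+ c) c c) ⟨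
        P₄                          ∎)

  -- The two triple products contain the classes 1, 4 and 2, 3 modulo 5, and each contains f₅. One
  -- copy of f₅ completes f₁, the other remains.
  θ-quintic : θ 1 4 * θ 2 3 ≈ F 1 * F 5
  θ-quintic = begin
    θ 1 4 * θ 2 3
      ≈⟨ *-cong (triple-product 1 4) (triple-product 2 3) ⟩
    (P 1 5 * P 4 5 * F 5) * (P 2 5 * P 3 5 * F 5)
      ≈⟨ solve 5 (λ a b c d e → (a :* d :* e) :* (b :* c :* e) := (con true :* a :* b :* c :* d :* e) :* e) ≈-refl
           (P 1 5) (P 2 5) (P 3 5) (P 4 5) (F 5) ⟩
    ∏< 5 (λ i → P (1 ℕ.+ 1 ℕ.* i) 5) * F 5
      ≈⟨ *-congʳ (P-residues 1 1 5) ⟨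
    F 1 * F 5 ∎

  -- Re-indexing of theta series

  private
    variable
      I J : Set

  -- xs enumerates, without repetition, at least all indices that contribute modulo q^N.
  record Exhausts (e : I → ℕ) (xs : List I) : Set where
    field
      unique   : Unique xs
      complete : ∀ i → e i < N → i ∈ xs
  open Exhausts

  Θ-filter : (e : I → ℕ) (xs : List I) → Θ e xs ≈ Θ e (filter (λ i → e i ℕ.<? N) xs)
  Θ-filter e []       = ≈-refl
  Θ-filter e (x ∷ xs) with e x ℕ.<? N
  ... | yes x<N = ≈-trans (+-congˡ (Θ-filter e xs))
    (≈-reflexive (cong (Θ e) (sym (filter-accept (λ i → e i ℕ.<? N) x<N))))
  ... | no  x≮N = ≈-trans (+-cong (q^-vanish (ℕ.≮⇒≥ x≮N)) (Θ-filter e xs)) (≈-trans (+-identityˡ _)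
    (≈-reflexive (cong (Θ e) (sym (filter-reject (λ i → e i ℕ.<? N) x≮N)))))

  Θ-↭ : (e : I → ℕ) {xs ys : List I} → xs ↭ ys → Θ e xs ≈ Θ e ys
  Θ-↭ e ↭.refl          = ≈-refl
  Θ-↭ e (↭.prep x p)    = +-congˡ (Θ-↭ e p)
  Θ-↭ e {x ∷ y ∷ xs} {_ ∷ _ ∷ ys} (↭.swap x y p) = begin
    (q^ e x) + ((q^ e y) + Θ e xs) ≈⟨ +-congˡ (+-congˡ (Θ-↭ e p)) ⟩
    (q^ e x) + ((q^ e y) + Θ e ys) ≈⟨ solve 3 (λ a b c → a :+ (b :+ c) := b :+ (a :+ c)) ≈-refl (q^ e x) (q^ e y) (Θ e ys) ⟩
    (q^ e y) + ((q^ e x) + Θ e ys) ∎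
  Θ-↭ e (↭.trans p r)   = ≈-trans (Θ-↭ e p) (Θ-↭ e r)

  -- Once the terms that vanish modulo `q^N` are filtered out, the two lists are permutations of
  -- each other.
  Θ-unique : {e : I → ℕ} {xs ys : List I} → Exhausts e xs → Exhausts e ys → Θ e xs ≈ Θ e ys
  Θ-unique {e = e} {xs} {ys} X Y = begin
    Θ e xs              ≈⟨ Θ-filter e xs ⟩
    Θ e (filter P? xs)  ≈⟨ Θ-↭ e (∼bag⇒↭ (unique∧set⇒bag (Unique.filter⁺ P? (unique X)) (Unique.filter⁺ P? (unique Y)) same)) ⟩
    Θ e (filter P? ys)  ≈⟨ Θ-filter e ys ⟨
    Θ e ys              ∎
    where
    P? = λ i → e i ℕ.<? N
    transfer : ∀ {zs ws z} → Exhausts e ws → z ∈ filter P? zs → z ∈ filter P? ws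
    transfer {zs} W z∈ = let _ , small = ∈.∈-filter⁻ P? {xs = zs} z∈ in ∈.∈-filter⁺ P? (complete W _ small) small
    same : ∀ {z} → _
    same {z} = mk⇔ (transfer {xs} {ys} {z} Y) (transfer {ys} {xs} X)

  Θ-map : (e : J → ℕ) (f : I → J) (xs : List I) → Θ e (map f xs) ≈ Θ (e ∘ f) xs
  Θ-map e f []       = ≈-refl
  Θ-map e f (x ∷ xs) = +-congˡ (Θ-map e f xs)

  Θ-cong : {e e′ : I → ℕ} → (∀ i → e i ≡ e′ i) → (xs : List I) → Θ e xs ≈ Θ e′ xs
  Θ-cong p []       = ≈-refl
  Θ-cong p (x ∷ xs) = +-cong (q^-cong (p x)) (Θ-cong p xs)

  Θ-bijection : {e : I → ℕ} {e′ : J → ℕ} (f : I ↔ J) → (∀ i → e i ≡ e′ (Inverse.to f i)) →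
    ∀ {xs ys} → Exhausts e xs → Exhausts e′ ys → Θ e xs ≈ Θ e′ ys
  Θ-bijection {e = e} {e′} f p {xs} {ys} X Y = begin
    Θ e xs           ≈⟨ Θ-cong p xs ⟩
    Θ (e′ ∘ to) xs   ≈⟨ Θ-map e′ to xs ⟨
    Θ e′ (map to xs) ≈⟨ Θ-unique image Y ⟩
    Θ e′ ys          ∎
    where
    open Inverse f using (to; from; strictlyInverseˡ; strictlyInverseʳ)
    image : Exhausts e′ (map to xs)
    image = record
      { unique   = Unique.map⁺ (λ {x} {y} q → trans (sym (strictlyInverseʳ x)) (trans (cong from q) (strictlyInverseʳ y))) (unique X)
      ; complete = λ j j<N → subst (_∈ map to xs) (strictlyInverseˡ j)
          (∈.∈-map⁺ to (complete X (from j)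
            (subst (_< N) (trans (cong e′ (sym (strictlyInverseˡ j))) (sym (p (from j)))) j<N)))
      }

  Θ-++ : (e : I → ℕ) (xs ys : List I) → Θ e (xs ++ ys) ≈ Θ e xs + Θ e ys
  Θ-++ e []       ys = ≈-sym (+-identityˡ _)
  Θ-++ e (x ∷ xs) ys = ≈-trans (+-congˡ (Θ-++ e xs ys)) (≈-sym (+-assoc _ _ _))

  Θ-shift : ∀ k (e : I → ℕ) (xs : List I) → Θ (λ i → k ℕ.+ e i) xs ≈ (q^ k) * Θ e xs
  Θ-shift k e []       = ≈-sym (zeroʳ _)
  Θ-shift k e (x ∷ xs) = ≈-trans (+-cong (q^-+ k (e x)) (Θ-shift k e xs)) (≈-sym (distribˡ _ _ _))

  module _ (e : I → ℕ) (e′ : J → ℕ) (xs : List I) (ys : List J) where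

    Θ-⊎ : Θ [ e , e′ ] (map inj₁ xs ++ map inj₂ ys) ≈ Θ e xs + Θ e′ ys
    Θ-⊎ = ≈-trans (Θ-++ _ (map inj₁ xs) (map inj₂ ys)) (+-cong (Θ-map _ inj₁ xs) (Θ-map _ inj₂ ys))

    exhausts-⊎ : Exhausts e xs → Exhausts e′ ys → Exhausts [ e , e′ ] (map inj₁ xs ++ map inj₂ ys)
    exhausts-⊎ X Y = record
      { unique   = Unique.++⁺ (Unique.map⁺ inj₁-injective (unique X)) (Unique.map⁺ inj₂-injective (unique Y)) disjoint
      ; complete = λ { (inj₁ i) l → ∈.∈-++⁺ˡ (∈.∈-map⁺ inj₁ (complete X i l))
                     ; (inj₂ j) l → ∈.∈-++⁺ʳ (map inj₁ xs) (∈.∈-map⁺ inj₂ (complete Y j l)) }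
      }
      where
      disjoint : ∀ {z} → z ∈ map inj₁ xs × z ∈ map inj₂ ys → _
      disjoint (p , r) with ∈.∈-map⁻ inj₁ p | ∈.∈-map⁻ inj₂ r
      ... | _ , _ , refl | _ , _ , ()

    Θ-× : Θ (λ (i , j) → e i ℕ.+ e′ j) (cartesianProduct xs ys) ≈ Θ e xs * Θ e′ ys
    Θ-× = go xs
      where
      go : ∀ xs → Θ (λ (i , j) → e i ℕ.+ e′ j) (cartesianProduct xs ys) ≈ Θ e xs * Θ e′ ys
      go []       = ≈-sym (zeroˡ _)
      go (x ∷ xs) = begin
        Θ _ (map (x ,_) ys ++ cartesianProduct xs ys)
          ≈⟨ Θ-++ _ (map (x ,_) ys) (cartesianProduct xs ys) ⟩
        Θ _ (map (x ,_) ys) + Θ _ (cartesianProduct xs ys)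
          ≈⟨ +-cong (≈-trans (Θ-map _ (x ,_) ys) (Θ-shift (e x) e′ ys)) (go xs) ⟩
        (q^ e x) * Θ e′ ys + Θ e xs * Θ e′ ys
          ≈⟨ distribʳ _ _ _ ⟨
        Θ e (x ∷ xs) * Θ e′ ys ∎

    exhausts-× : Exhausts e xs → Exhausts e′ ys → Exhausts (λ (i , j) → e i ℕ.+ e′ j) (cartesianProduct xs ys)
    exhausts-× X Y = record
      { unique   = Unique.cartesianProduct⁺ (unique X) (unique Y)
      ; complete = λ (i , j) l → ∈.∈-cartesianProduct⁺
          (complete X i (ℕ.≤-<-trans (ℕ.m≤m+n (e i) (e′ j)) l))
          (complete Y j (ℕ.≤-<-trans (ℕ.m≤n+m (e′ j) (e i)) l))
      }

  exhausts-shift : ∀ k {e : I → ℕ} {xs} → Exhausts e xs → Exhausts (λ i → k ℕ.+ e i) xs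
  exhausts-shift k {e} X = record
    { unique = unique X ; complete = λ i l → complete X i (ℕ.≤-<-trans (ℕ.m≤n+m (e i) k) l) }

  exhausts-range : ∀ a b .{{_ : NonZero a}} .{{_ : NonZero b}} → Exhausts (exponent a b) (range (N ℕ.+ N))
  exhausts-range a b = record
    { unique   = Unique.applyUpTo⁺₁ (_⊖ n) _ λ {i} {j} i<j _ p → ℕ.<⇒≢ i<j (⊖-injective i j p)
    ; complete = λ j l → member j (ℕ.≤-trans (ℕ.<⇒≤ (ℕ.≤-<-trans (∣j∣≤exponent a b j) l)) (ℕ.m≤m+n N N))
    }
    where
    n = N ℕ.+ N
    ⊖-injective : ∀ i j → i ⊖ n ≡ j ⊖ n → i ≡ j
    ⊖-injective i j p = ℤ.+-injective (ℤGroup.∙-cancelʳ (ℤ.- + n) (+ i) (+ j)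
      (trans (ℤ.m-n≡m⊖n i n) (trans p (sym (ℤ.m-n≡m⊖n j n)))))
    member : ∀ j → ∣ j ∣ ≤ n → j ∈ range n
    member (+ k) k≤n = subst (_∈ range n)
      (trans (ℤ.⊖-≥ (ℕ.m≤n+m n k)) (cong +_ (ℕ.m+n∸n≡m k n)))
      (∈.∈-applyUpTo⁺ (_⊖ n) (s≤s (ℕ.+-monoˡ-≤ n k≤n)))
    member -[1+ k ] k<n = subst (_∈ range n)
      (trans (ℤ.⊖-≤ (ℕ.m∸n≤m n (suc k))) (cong (λ z → ℤ.- + z) (ℕ.m∸[m∸n]≡n k<n)))
      (∈.∈-applyUpTo⁺ (_⊖ n) (s≤s (ℕ.≤-trans (ℕ.m∸n≤m n (suc k)) (ℕ.m≤m+n n n))))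

  -- The identity for f₁ f₅ and the dissection modulo 4

  private
    x y w : Series
    x = F 1
    y = F 5
    w = q^ 1

    ℤs : List ℤ
    ℤs = range (N ℕ.+ N)

    ℤ²s : List (ℤ × ℤ)
    ℤ²s = cartesianProduct ℤs ℤs

  θ-lattice : θ 1 4 * θ 2 3 + w * (θ 30 10 * θ 5 5) ≈ θ 6 2 * θ 1 1
  θ-lattice = begin
    θ 1 4 * θ 2 3 + w * (θ 30 10 * θ 5 5)
      ≈⟨ +-cong (Θ-× (exponent 1 4) (exponent 2 3) ℤs ℤs)
           (≈-trans (Θ-shift 1 _ ℤ²s) (*-congˡ (Θ-× (exponent 30 10) (exponent 5 5) ℤs ℤs))) ⟨
    Θ e₁ ℤ²s + Θ e₃ ℤ²s
      ≈⟨ Θ-⊎ e₁ e₃ ℤ²s ℤ²s ⟨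
    Θ [ e₁ , e₃ ] (map inj₁ ℤ²s ++ map inj₂ ℤ²s)
      ≈⟨ Θ-bijection lattice lattice-exponent
           (exhausts-⊎ e₁ e₃ ℤ²s ℤ²s (product 1 4 2 3) (exhausts-shift 1 (product 30 10 5 5))) (product 6 2 1 1) ⟩
    Θ e₂ ℤ²s
      ≈⟨ Θ-× (exponent 6 2) (exponent 1 1) ℤs ℤs ⟩
    θ 6 2 * θ 1 1 ∎
    where
    product : ∀ a b c d .{{_ : NonZero a}} .{{_ : NonZero b}} .{{_ : NonZero c}} .{{_ : NonZero d}} →
      Exhausts (λ (i , j) → exponent a b i ℕ.+ exponent c d j) ℤ²s
    product a b c d = exhausts-× (exponent a b) (exponent c d) ℤs ℤs (exhausts-range a b) (exhausts-range c d)

  F₁F₅ : x * y ≈ x * x * (x * x) * (x * x) + w * (y * y * (y * y) * (y * y))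
  F₁F₅ = begin
    x * y
      -- The term q f₁₀³ is added twice, which changes nothing in characteristic 2: one copy joins
      -- f₁ f₅ to form the left side of `θ-lattice`, the other survives in the result.
      ≈⟨ solve 3 (λ x y t → x :* y := x :* y :+ t :* con true :+ t :* con true) ≈-refl x y (w * c) ⟩
    x * y + w * c * 1ₛ + w * c * 1ₛ
      ≈⟨ +-congʳ (+-cong (≈-sym θ-quintic) (≈-trans (*-cong (*-congˡ (≈-sym (θ-triangular 10))) (≈-sym (θ-squares 5)))
           (*-assoc w _ _))) ⟩
    θ 1 4 * θ 2 3 + w * (θ 30 10 * θ 5 5) + w * c * 1ₛ
      ≈⟨ +-congʳ θ-lattice ⟩
    θ 6 2 * θ 1 1 + w * c * 1ₛ
      ≈⟨ +-congʳ (*-cong (θ-triangular 2) (θ-squares 1)) ⟩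
    F 2 * F 2 * F 2 * 1ₛ + w * c * 1ₛ
      ≈⟨ solve 3 (λ a b w → a :* a :* a :* con true :+ w :* (b :* b :* b) :* con true := a :* a :* a :+ w :* (b :* b :* b))
           ≈-refl (F 2) (F 10) w ⟩
    F 2 * F 2 * F 2 + w * (F 10 * F 10 * F 10)
      ≈⟨ +-cong (cube (F-square 1)) (*-congˡ (cube (F-square 5))) ⟨
    x * x * (x * x) * (x * x) + w * (y * y * (y * y) * (y * y)) ∎
    where
    c = F 10 * F 10 * F 10
    cube : ∀ {a b} → a ≈ b → a * a * a ≈ b * b * b
    cube p = *-cong (*-cong p p) p

  -- The denominator is made a fourth power: g = y / x = x² (x y) / x⁴. Substituting for x y gives
  -- x⁴ + q y⁴ (x y)² / x⁴, and substituting in the square gives q x⁸ y⁴ + q³ y¹⁶ / x⁴. Up to the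
  -- powers of q, everything is then a fourth power.
  dissection : ∀ {g v} → g * x ≈ y → x * v ≈ 1ₛ →
    g ≈ x * x * (x * x) + w * (F 8 * F 20)
      + w * (w * (w * (y * y * (y * y) * v * (y * y * (y * y) * v) * (y * y * (y * y) * v * (y * y * (y * y) * v)))))
  dissection {g} {v} gx≈y xv≈1 = begin
    g
      ≈⟨ solve 1 (λ g → g := g :* (con true :^ 4)) ≈-refl g ⟩
    g * pow4 1ₛ
      ≈⟨ *-congˡ (pow4-cong (≈-sym xv≈1)) ⟩
    g * pow4 (x * v)
      ≈⟨ solve 3 (λ g x v → g :* ((x :* v) :^ 4) := g :* x :* (x :^ 3 :* v :^ 4)) ≈-refl g x v ⟩
    g * x * (x * (x * (x * 1ₛ)) * pow4 v)
      ≈⟨ *-congʳ gx≈y ⟩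
    y * (x * (x * (x * 1ₛ)) * pow4 v)
      ≈⟨ solve 3 (λ x y v → y :* (x :^ 3 :* v :^ 4) := x :* x :* (x :* y) :* v :^ 4) ≈-refl x y v ⟩
    x * x * (x * y) * pow4 v
      ≈⟨ *-congʳ (*-congˡ F₁F₅) ⟩
    x * x * (x * x * (x * x) * (x * x) + w * (y * y * (y * y) * (y * y))) * pow4 v
      ≈⟨ solve 4 (λ x y v w → x :* x :* (x :* x :* (x :* x) :* (x :* x) :+ w :* (y :* y :* (y :* y) :* (y :* y))) :* v :^ 4
           := x :^ 4 :* (x :* v) :^ 4 :+ w :* y :^ 4 :* ((x :* y) :* (x :* y)) :* v :^ 4) ≈-refl x y v w ⟩
    pow4 x * pow4 (x * v) + w * pow4 y * ((x * y) * (x * y)) * pow4 v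
      ≈⟨ +-congˡ (*-congʳ (*-congˡ (*-cong F₁F₅ F₁F₅))) ⟩
    pow4 x * pow4 (x * v) + w * pow4 y * (d * d) * pow4 v
      ≈⟨ solve 4 (λ x y v w → x :^ 4 :* (x :* v) :^ 4
             :+ w :* y :^ 4 :* ((x :* x :* (x :* x) :* (x :* x) :+ w :* (y :* y :* (y :* y) :* (y :* y)))
                             :* (x :* x :* (x :* x) :* (x :* x) :+ w :* (y :* y :* (y :* y) :* (y :* y)))) :* v :^ 4
           := x :^ 4 :* (x :* v) :^ 4 :+ w :* (x :^ 8 :* y :^ 4) :* (x :* v) :^ 4
             :+ w :* (w :* (w :* (y :* y :* (y :* y) :* v :* (y :* y :* (y :* y) :* v)
                               :* (y :* y :* (y :* y) :* v :* (y :* y :* (y :* y) :* v)))))) ≈-refl x y v w ⟩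
    pow4 x * pow4 (x * v) + w * (pow8 x * pow4 y) * pow4 (x * v) + r
      ≈⟨ +-congʳ (+-cong (*-congˡ (pow4-cong xv≈1)) (*-congˡ (pow4-cong xv≈1))) ⟩
    pow4 x * pow4 1ₛ + w * (pow8 x * pow4 y) * pow4 1ₛ + r
      ≈⟨ +-congʳ (solve 3 (λ x y w → x :^ 4 :* con true :^ 4 :+ w :* (x :^ 8 :* y :^ 4) :* con true :^ 4
           := x :* x :* (x :* x) :+ w :* ((x :* x :* (x :* x)) :* (x :* x :* (x :* x)) :* (y :* y :* (y :* y)))) ≈-refl x y w) ⟩
    x * x * (x * x) + w * (x * x * (x * x) * (x * x * (x * x)) * (y * y * (y * y))) + r
      ≈⟨ +-congʳ (+-congˡ (*-congˡ (*-cong (square (square (F-square 1) (F-square 2)) (F-square 4)) (square (F-square 5) (F-square 10))))) ⟩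
    x * x * (x * x) + w * (F 8 * F 20) + r ∎
    where
    -- The trailing `1ₛ` is there because `:^` evaluates to iterated multiplication ending in 1.
    pow4 pow8 : Series → Series
    pow4 a = a * (a * (a * (a * 1ₛ)))
    pow8 a = a * (a * (a * (a * pow4 a)))
    pow4-cong : ∀ {a b} → a ≈ b → pow4 a ≈ pow4 b
    pow4-cong p = *-cong p (*-cong p (*-cong p (*-congʳ p)))
    square : ∀ {a b c} → a ≈ b → b * b ≈ c → a * a ≈ c
    square p e = ≈-trans (*-cong p p) e
    d = x * x * (x * x) * (x * x) + w * (y * y * (y * y) * (y * y))
    r = w * (w * (w * (y * y * (y * y) * v * (y * y * (y * y) * v) * (y * y * (y * y) * v * (y * y * (y * y) * v)))))

  -- The outer terms have exponents ≡ 0 and ≡ 3 (mod 4). A nonzero coefficient of the middle one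
  -- forces some pair of terms of its two pentagonal series to meet the exponent.
  support-1-mod-4 : ∀ {g} → g * x ≈ y → ∀ m → 1 ℕ.+ 4 ℕ.* m < N → g (1 ℕ.+ 4 ℕ.* m) ≡ true →
    ∃₂ λ i j → exponent 16 8 i ℕ.+ exponent 40 20 j ≡ 4 ℕ.* m
  support-1-mod-4 {g} gx≈y m small odd =
    +-support (x * x * (x * x) + w * (θ 16 8 * θ 40 20)) (w * (w * (w * z⁴)))
      (+-support (x * x * (x * x)) (w * (θ 16 8 * θ 40 20))
        (λ p → contradiction (ℕ.∣m+n∣m⇒∣n (subst (4 ∣_) (ℕ.+-comm 1 (4 ℕ.* m)) (fourth-power-support x _ p)) 4∣4m) 4∤1)
        solution)
      (λ p → contradiction (third p) 4∤2)
      (trans (sym (coefficient expansion _ small)) odd)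
    where
    v = proj₁ (unit-qProduct 1 1 N)
    z = y * y * (y * y) * v
    z⁴ = z * z * (z * z)
    4∣4m : 4 ∣ 4 ℕ.* m
    4∣4m = ℕ.m∣m*n m
    4∤1 : ¬ 4 ∣ 1
    4∤1 p = contradiction (ℕ.∣⇒≤ p) λ { (s≤s ()) }
    4∤2 : ¬ 4 ∣ 2
    4∤2 p = contradiction (ℕ.∣⇒≤ p) λ { (s≤s (s≤s ())) }
    expansion : g ≈ x * x * (x * x) + w * (θ 16 8 * θ 40 20) + w * (w * (w * z⁴))
    expansion = ≈-trans (dissection gx≈y (proj₂ (unit-qProduct 1 1 N)))
      (+-congʳ (+-congˡ (*-congˡ (≈-sym (*-cong (θ-pentagonal 8) (θ-pentagonal 20))))))
    solution : (w * (θ 16 8 * θ 40 20)) (1 ℕ.+ 4 ℕ.* m) ≡ true →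
      ∃₂ λ i j → exponent 16 8 i ℕ.+ exponent 40 20 j ≡ 4 ℕ.* m
    solution p =
      let n , s , u = q^*-support 1 (θ 16 8 * θ 40 20) _ p
          _ , _ , t , u₁ , u₂ = *-support (θ 16 8) (θ 40 20) n u
          i , e = Θ-support (exponent 16 8) ℤs u₁
          j , e′ = Θ-support (exponent 40 20) ℤs u₂
      in i , j , trans (cong₂ ℕ._+_ e e′) (trans t (ℕ.suc-injective s))
    third : (w * (w * (w * z⁴))) (1 ℕ.+ 4 ℕ.* m) ≡ true → 4 ∣ 2
    third p =
      let n₁ , s₁ , u₁ = q^*-support 1 (w * (w * z⁴)) _ p
          n₂ , s₂ , u₂ = q^*-support 1 (w * z⁴) _ u₁
          n₃ , s₃ , u₃ = q^*-support 1 z⁴ _ u₂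
      in ℕ.∣m+n∣m⇒∣n (subst (4 ∣_)
           (trans (sym (ℕ.suc-injective (trans (cong (suc ∘ suc) s₃) (trans (cong suc s₂) s₁)))) (ℕ.+-comm 2 n₃)) 4∣4m)
           (fourth-power-support z _ u₃)

  -- The generating function of b₅ modulo 2

  boundedSeries-zero : boundedSeries 0 ≈ 1ₛ
  boundedSeries-zero = agree value
    where
    value : ∀ n → n < N → boundedSeries 0 n ≡ 1ₛ n
    value zero    _ = refl
    value (suc n) _ = cong (odd ∘ length) (empty (boundedPartitions 5 0 (suc n)) (∈-bounded⁻ 5 0 (suc n)))
      where
      empty : ∀ ps → (∀ {p} → p ∈ ps → IsPartition (suc n) p × Bounded 5 0 p) → ps ≡ []
      empty []       _ = refl
      empty (p ∷ ps) f with f (here refl)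
      empty ([] ∷ ps)      f | record { total = () } , _
      empty ((x ∷ p) ∷ ps) f | ip , _ , x≤0 ∷ _ =
        contradiction (All.head (IsPartition.positive ip)) (ℕ.≤⇒≯ x≤0)

  boundedSeries-multiple : ∀ m → 5 ∣ suc m → boundedSeries (suc m) ≈ boundedSeries m
  boundedSeries-multiple m 5∣ = agree λ n _ → cong odd (bounded-multiple 5 m n 5∣)

  boundedSeries-suc : ∀ m → ¬ 5 ∣ suc m → boundedSeries (suc m) * (1ₛ + (q^ suc m)) ≈ boundedSeries m
  boundedSeries-suc m 5∤ = begin
    B * (1ₛ + z)
      ≈⟨ solve 2 (λ B z → B :* (con true :+ z) := B :+ z :* B) ≈-refl B z ⟩
    B + z * B
      ≈⟨ +-congʳ recurrence ⟩
    boundedSeries m + z * B + z * B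
      ≈⟨ solve 2 (λ A C → A :+ C :+ C := A) ≈-refl (boundedSeries m) (z * B) ⟩
    boundedSeries m ∎
    where
    B = boundedSeries (suc m)
    z = q^ suc m
    value : ∀ n → Dec (n < suc m) → B n ≡ boundedSeries m n xor (z * B) n
    value n (yes n<) = trans (cong odd (bounded-small 5 (ℕ.≤-pred n<)))
      (sym (trans (cong (boundedSeries m n xor_) (q^*-coefficient-< (suc m) B n<)) (xor-identityʳ _)))
    value n (no n≮) with k , refl ← ℕ.m≤n⇒∃[o]m+o≡n (ℕ.≮⇒≥ n≮) =
      trans (cong odd (bounded-suc 5 m k 5∤))
        (trans (odd-+ (length (boundedPartitions 5 m (suc m ℕ.+ k))) _)
          (cong (boundedSeries m (suc m ℕ.+ k) xor_) (sym (q^*-coefficient (suc m) B k))))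
    recurrence : B ≈ boundedSeries m + z * B
    recurrence = agree λ n _ → trans (value n (n ℕ.<? suc m)) (sym (+-coefficient (boundedSeries m) (z * B) n))

  -- Induction in blocks of five part sizes: the four that are prime to 5 each cancel one factor of
  -- `qProduct 1 1`, while the multiple of 5 leaves its factor to the right side.
  boundedSeries-product : ∀ n → boundedSeries (n ℕ.* 5) * qProduct 1 1 (n ℕ.* 5) ≈ qProduct 5 5 n
  boundedSeries-product zero    = ≈-trans (*-identityʳ _) boundedSeries-zero
  boundedSeries-product (suc n) = begin
    boundedSeries (5 ℕ.+ k) * (Q * (1ₛ + a 0) * (1ₛ + a 1) * (1ₛ + a 2) * (1ₛ + a 3) * (1ₛ + a 4))
      ≈⟨ *-congʳ (boundedSeries-multiple (4 ℕ.+ k) (ℕ.∣m∣n⇒∣m+n (divides 1 refl) (ℕ.n∣m*n n))) ⟩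
    boundedSeries (4 ℕ.+ k) * (Q * (1ₛ + a 0) * (1ₛ + a 1) * (1ₛ + a 2) * (1ₛ + a 3) * (1ₛ + a 4))
      ≈⟨ solve 7 (λ B Q a b c d e → B :* (Q :* a :* b :* c :* d :* e) := (B :* d :* c :* b :* a) :* Q :* e) ≈-refl
           (boundedSeries (4 ℕ.+ k)) Q (1ₛ + a 0) (1ₛ + a 1) (1ₛ + a 2) (1ₛ + a 3) (1ₛ + a 4) ⟩
    boundedSeries (4 ℕ.+ k) * (1ₛ + a 3) * (1ₛ + a 2) * (1ₛ + a 1) * (1ₛ + a 0) * Q * (1ₛ + a 4)
      ≈⟨ *-congʳ (*-congʳ (step 0 (from-no (5 ∣? 1)) (step 1 (from-no (5 ∣? 2)) (step 2 (from-no (5 ∣? 3))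
           (step 3 (from-no (5 ∣? 4)) ≈-refl))))) ⟩
    boundedSeries k * Q * (1ₛ + a 4)
      ≈⟨ *-cong (boundedSeries-product n) (+-congˡ (q^-cong (exponent₅ n))) ⟩
    qProduct 5 5 (suc n) ∎
    where
    k = n ℕ.* 5
    Q = qProduct 1 1 k
    a : ℕ → Series
    a i = q^ (1 ℕ.+ 1 ℕ.* (i ℕ.+ k))
    exponent₅ : ∀ n → 1 ℕ.+ 1 ℕ.* (4 ℕ.+ n ℕ.* 5) ≡ 5 ℕ.+ 5 ℕ.* n
    exponent₅ = ℕRing.solve-∀
    step : ∀ i → ¬ 5 ∣ suc i → ∀ {f} → f ≈ boundedSeries (suc i ℕ.+ k) → f * (1ₛ + a i) ≈ boundedSeries (i ℕ.+ k)
    step i 5∤ p = ≈-trans (*-cong p (+-congˡ (q^-cong (cong suc (ℕ.*-identityˡ (i ℕ.+ k))))))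
      (boundedSeries-suc (i ℕ.+ k) λ 5∣ → 5∤ (ℕ.∣m+n∣m⇒∣n (subst (5 ∣_) (ℕ.+-comm (suc i) k) 5∣) (ℕ.n∣m*n n)))

  regularSeries : Series
  regularSeries n = odd (b 5 n)

  regularSeries-product : regularSeries * F 1 ≈ F 5
  regularSeries-product = begin
    regularSeries * F 1
      ≈⟨ *-cong (agree λ n n<N → cong odd (bounded-total 5 (ℕ.≤-trans (ℕ.<⇒≤ n<N) (ℕ.m≤m*n N 5))))
                (qProduct-stable 1 1 (ℕ.m≤m*n N 5)) ⟨
    boundedSeries (N ℕ.* 5) * qProduct 1 1 (N ℕ.* 5)
      ≈⟨ boundedSeries-product N ⟩
    F 5 ∎

-- The quadratic form 2x² + 5y²

-- Completing the square: (6j + 1)² = 1 + 24 j (3j + 1) / 2.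
pentagonal-square : ∀ j → ∃ λ x → x ℕ.* x ≡ 1 ℕ.+ 24 ℕ.* exponent 2 1 j
pentagonal-square j = ∣ z ∣ , trans (sym (ℤ.abs-* z z)) (cong ∣_∣ square)
  where
  z = + 6 ℤ.* j ℤ.+ + 1
  square : z ℤ.* z ≡ + (1 ℕ.+ 24 ℕ.* exponent 2 1 j)
  square = trans (ring j) (cong (λ w → + 1 ℤ.+ w)
    (trans (cong (+ 12 ℤ.*_) (sym (double-exponent 2 1 j)))
      (trans (sym (ℤ.*-assoc (+ 12) (+ 2) (+ exponent 2 1 j))) (sym (ℤ.pos-* 24 (exponent 2 1 j))))))
    where
    ring : ∀ j → (+ 6 ℤ.* j ℤ.+ + 1) ℤ.* (+ 6 ℤ.* j ℤ.+ + 1)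
      ≡ + 1 ℤ.+ + 12 ℤ.* (+ 2 ℤ.* (j ℤ.* (j ℤ.+ + 1)) ℤ.+ + 1 ℤ.* (j ℤ.* (j ℤ.- + 1)))
    ring = ℤRing.solve-∀

Represented : ℕ → Set
Represented M = ∃₂ λ x y → 2 ℕ.* (x ℕ.* x) ℕ.+ 5 ℕ.* (y ℕ.* y) ≡ M

-- With pentagonal numbers p and p′ satisfying 4m = 8p + 20p′, one has 6 (1 + 4m) + 1 = 2 (1 + 24p)
-- + 5 (1 + 24p′), and both brackets are squares.
odd⇒represented : ∀ m → odd (b 5 (1 ℕ.+ 4 ℕ.* m)) ≡ true → Represented (6 ℕ.* (1 ℕ.+ 4 ℕ.* m) ℕ.+ 1)
odd⇒represented m p =
  let i , j , s = Modulo.support-1-mod-4 N (Modulo.regularSeries-product N) m ℕ.≤-refl p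
      x , x² = pentagonal-square i
      y , y² = pentagonal-square j
  in x , y , trans (cong₂ (λ u v → 2 ℕ.* u ℕ.+ 5 ℕ.* v) x² y²)
       (trans (ring (triangle⁺ i) (triangle⁻ i) (triangle⁺ j) (triangle⁻ j))
         (cong (λ u → 6 ℕ.* (1 ℕ.+ u) ℕ.+ 1) s))
  where
  -- The least modulus that still shows the coefficient at 1 + 4m.
  N = 2 ℕ.+ 4 ℕ.* m
  ring : ∀ s t u v → 2 ℕ.* (1 ℕ.+ 24 ℕ.* (2 ℕ.* s ℕ.+ 1 ℕ.* t)) ℕ.+ 5 ℕ.* (1 ℕ.+ 24 ℕ.* (2 ℕ.* u ℕ.+ 1 ℕ.* v))
    ≡ 6 ℕ.* (1 ℕ.+ ((16 ℕ.* s ℕ.+ 8 ℕ.* t) ℕ.+ (40 ℕ.* u ℕ.+ 20 ℕ.* v))) ℕ.+ 1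
  ring = ℕRing.solve-∀

-- Descent and residues modulo 5

5-prime : Prime 5
5-prime = from-yes (prime? 5)

5∣square : ∀ x → 5 ∣ x ℕ.* x → 5 ∣ x
5∣square x = [ id , id ]′ ∘ euclidsLemma x x 5-prime

5∣2square : ∀ x → 5 ∣ 2 ℕ.* (x ℕ.* x) → 5 ∣ x
5∣2square x p = [ (λ q → contradiction q (from-no (5 ∣? 2))) , 5∣square x ]′ (euclidsLemma 2 (x ℕ.* x) 5-prime p)

-- Since 2 is not a square modulo 5, 5 divides x in 2x² + 5y² = 5M.
represented-5* : ∀ {M} → Represented (5 ℕ.* M) → ∃₂ λ x y → 10 ℕ.* (x ℕ.* x) ℕ.+ y ℕ.* y ≡ M
represented-5* {M} (x , y , p) with 5∣2square x
  (ℕ.∣m+n∣m⇒∣n (subst (5 ∣_) (trans (sym p) (ℕ.+-comm (2 ℕ.* (x ℕ.* x)) _)) (ℕ.m∣m*n M)) (ℕ.m∣m*n (y ℕ.* y)))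
... | divides x′ refl = x′ , y , ℕ.*-cancelˡ-≡ _ M 5 (trans (ring x′ y) p)
  where
  ring : ∀ x y → 5 ℕ.* (10 ℕ.* (x ℕ.* x) ℕ.+ y ℕ.* y) ≡ 2 ℕ.* (x ℕ.* 5 ℕ.* (x ℕ.* 5)) ℕ.+ 5 ℕ.* (y ℕ.* y)
  ring = ℕRing.solve-∀

-- Division by 5 exchanges the forms 2x² + 5y² and 10x² + y². From 10x² + y² = 5M it follows that 5
-- divides y, and a second division leads back to the first form.
represented-25* : ∀ {M} → Represented (25 ℕ.* M) → Represented M
represented-25* {M} r = descend (represented-5* (subst Represented (ring₁ M) r))
  where
  ring₁ : ∀ M → 25 ℕ.* M ≡ 5 ℕ.* (5 ℕ.* M)
  ring₁ = ℕRing.solve-∀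
  ring₂ : ∀ x y → 5 ℕ.* (2 ℕ.* (x ℕ.* x) ℕ.+ 5 ℕ.* (y ℕ.* y)) ≡ 10 ℕ.* (x ℕ.* x) ℕ.+ y ℕ.* 5 ℕ.* (y ℕ.* 5)
  ring₂ = ℕRing.solve-∀
  descend : (∃₂ λ x y → 10 ℕ.* (x ℕ.* x) ℕ.+ y ℕ.* y ≡ 5 ℕ.* M) → Represented M
  descend (x , y , p) with divides y′ refl ← 5∣square y (ℕ.∣m+n∣m⇒∣n (subst (5 ∣_) (sym p) (ℕ.m∣m*n M))
                                               (ℕ.∣m⇒∣m*n (x ℕ.* x) (divides 2 refl))) =
    x , y′ , ℕ.*-cancelˡ-≡ _ M 5 (trans (ring₂ x y′) p)

represented-25^* : ∀ α {M} → Represented (25 ^ α ℕ.* M) → Represented M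
represented-25^* zero    {M} r = subst Represented (ℕ.*-identityˡ M) r
represented-25^* (suc α) {M} r =
  represented-25^* α (represented-25* (subst Represented (ℕ.*-assoc 25 (25 ^ α) M) r))

square%5 : ∀ c x → (c ℕ.* (x ℕ.* x)) % 5 ≡ (c ℕ.* (x % 5 ℕ.* (x % 5))) % 5
square%5 c x = trans (ℕ.%-distribˡ-* c (x ℕ.* x) 5)
  (trans (cong (λ z → (c % 5 ℕ.* z) % 5) (ℕ.%-distribˡ-* x x 5)) (sym (ℕ.%-distribˡ-* c (x % 5 ℕ.* (x % 5)) 5)))

-- Quantifying over the five residues only makes this decidable by a finite check.
Avoids : ℕ → ℕ → Set
Avoids c r = ∀ {s} → s < 5 → (c ℕ.* (s ℕ.* s)) % 5 ≢ r

avoids? : ∀ c r → Dec (Avoids c r)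
avoids? c r = ℕ.allUpTo? (λ s → ¬? ((c ℕ.* (s ℕ.* s)) % 5 ℕ.≟ r)) 5

avoids-square : ∀ c r k → Avoids c (r % 5) → ∀ x l → c ℕ.* (x ℕ.* x) ℕ.+ l ℕ.* 5 ≢ r ℕ.+ k ℕ.* 5
avoids-square c r k avoid x l p = avoid (ℕ.m%n<n x 5) (trans (sym (square%5 c x))
  (trans (sym (ℕ.[m+kn]%n≡m%n (c ℕ.* (x ℕ.* x)) l 5)) (trans (cong (_% 5) p) (ℕ.[m+kn]%n≡m%n r k 5))))

¬represented : ∀ r k → Avoids 2 (r % 5) → ¬ Represented (r ℕ.+ k ℕ.* 5)
¬represented r k avoid (x , y , p) = avoids-square 2 r k avoid x (y ℕ.* y)
  (trans (cong (2 ℕ.* (x ℕ.* x) ℕ.+_) (ℕ.*-comm (y ℕ.* y) 5)) p)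

-- After one division by 5 the form is 10x² + y², which modulo 5 is just y².
¬represented-5* : ∀ r k → Avoids 1 (r % 5) → ¬ Represented (5 ℕ.* (r ℕ.+ k ℕ.* 5))
¬represented-5* r k avoid rep with x , y , p ← represented-5* rep =
  avoids-square 1 r k avoid y (2 ℕ.* (x ℕ.* x)) (trans (ring x y) p)
  where
  ring : ∀ x y → 1 ℕ.* (y ℕ.* y) ℕ.+ 2 ℕ.* (x ℕ.* x) ℕ.* 5 ≡ 10 ℕ.* (x ℕ.* x) ℕ.+ y ℕ.* y
  ring = ℕRing.solve-∀

-- Hence multiplying c ≡ 7 (mod 24) by a power of 25 keeps the class, so that (c 25^α - 1) / 6 is an
-- integer ≡ 1 (mod 4).
25^≡1-mod-24 : ∀ α → ∃ λ t → 25 ^ α ≡ 1 ℕ.+ 24 ℕ.* t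
25^≡1-mod-24 zero    = 0 , refl
25^≡1-mod-24 (suc α) with t , p ← 25^≡1-mod-24 α =
  1 ℕ.+ 25 ℕ.* t , trans (cong (25 ℕ.*_) p) (ring t)
  where
  ring : ∀ t → 25 ℕ.* (1 ℕ.+ 24 ℕ.* t) ≡ 1 ℕ.+ 24 ℕ.* (1 ℕ.+ 25 ℕ.* t)
  ring = ℕRing.solve-∀

-- With N the argument of b, 6 N + 1 = 25^α (24 A n + c); this is the number to be represented.
b-even : ∀ A d α n → (let c = 7 ℕ.+ 24 ℕ.* d) → ¬ Represented (24 ℕ.* A ℕ.* n ℕ.+ c) →
  b 5 (4 ℕ.* (A ℕ.* 25 ^ α) ℕ.* n ℕ.+ (c ℕ.* 25 ^ α ∸ 1) / 6) % 2 ≡ 0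
b-even A d α n unrepresented with t , 25^α ← 25^≡1-mod-24 α =
  subst (λ N → b 5 N % 2 ≡ 0) (sym index) (¬odd⇒even (b 5 (1 ℕ.+ 4 ℕ.* m)) (not-odd (odd (b 5 (1 ℕ.+ 4 ℕ.* m))) refl))
  where
  c = 7 ℕ.+ 24 ℕ.* d
  -- Chosen so that the argument of `b` is 1 + 4m.
  m = A ℕ.* 25 ^ α ℕ.* n ℕ.+ d ℕ.+ c ℕ.* t
  quotient : (c ℕ.* 25 ^ α ∸ 1) / 6 ≡ 1 ℕ.+ 4 ℕ.* d ℕ.+ 4 ℕ.* c ℕ.* t
  quotient = trans (cong (λ z → (z ∸ 1) / 6) (trans (cong (c ℕ.*_) 25^α) (ring d t)))
    (ℕ.m*n/n≡m (1 ℕ.+ 4 ℕ.* d ℕ.+ 4 ℕ.* c ℕ.* t) 6)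
    where
    ring : ∀ d t → (7 ℕ.+ 24 ℕ.* d) ℕ.* (1 ℕ.+ 24 ℕ.* t)
      ≡ 1 ℕ.+ (1 ℕ.+ 4 ℕ.* d ℕ.+ 4 ℕ.* (7 ℕ.+ 24 ℕ.* d) ℕ.* t) ℕ.* 6
    ring = ℕRing.solve-∀
  index : 4 ℕ.* (A ℕ.* 25 ^ α) ℕ.* n ℕ.+ (c ℕ.* 25 ^ α ∸ 1) / 6 ≡ 1 ℕ.+ 4 ℕ.* m
  index = trans (cong (4 ℕ.* (A ℕ.* 25 ^ α) ℕ.* n ℕ.+_) quotient) (ring A (25 ^ α) n d c t)
    where
    ring : ∀ A P n d c t → 4 ℕ.* (A ℕ.* P) ℕ.* n ℕ.+ (1 ℕ.+ 4 ℕ.* d ℕ.+ 4 ℕ.* c ℕ.* t)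
      ≡ 1 ℕ.+ 4 ℕ.* (A ℕ.* P ℕ.* n ℕ.+ d ℕ.+ c ℕ.* t)
    ring = ℕRing.solve-∀
  value : 6 ℕ.* (1 ℕ.+ 4 ℕ.* m) ℕ.+ 1 ≡ 25 ^ α ℕ.* (24 ℕ.* A ℕ.* n ℕ.+ c)
  value = trans (ring₁ A (25 ^ α) n d t)
    (trans (cong (λ z → 24 ℕ.* A ℕ.* n ℕ.* 25 ^ α ℕ.+ c ℕ.* z) (sym 25^α)) (ring₂ (24 ℕ.* A ℕ.* n) (25 ^ α) c))
    where
    ring₁ : ∀ A P n d t → 6 ℕ.* (1 ℕ.+ 4 ℕ.* (A ℕ.* P ℕ.* n ℕ.+ d ℕ.+ (7 ℕ.+ 24 ℕ.* d) ℕ.* t)) ℕ.+ 1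
      ≡ 24 ℕ.* A ℕ.* n ℕ.* P ℕ.+ (7 ℕ.+ 24 ℕ.* d) ℕ.* (1 ℕ.+ 24 ℕ.* t)
    ring₁ = ℕRing.solve-∀
    ring₂ : ∀ K P c → K ℕ.* P ℕ.+ c ℕ.* P ≡ P ℕ.* (K ℕ.+ c)
    ring₂ = ℕRing.solve-∀
  not-odd : ∀ o → odd (b 5 (1 ℕ.+ 4 ℕ.* m)) ≡ o → o ≡ false
  not-odd false _ = refl
  not-odd true  p = contradiction (represented-25^* α (subst Represented value (odd⇒represented m p))) unrepresented

5^even : ∀ α → 5 ^ (2 ℕ.* α) ≡ 25 ^ α
5^even α = sym (ℕ.^-*-assoc 5 2 α)

5^even+ : ∀ α k → 5 ^ (2 ℕ.* α ℕ.+ k) ≡ 5 ^ k ℕ.* 25 ^ α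
5^even+ α k = trans (ℕ.^-distribˡ-+-* 5 (2 ℕ.* α) k)
  (trans (cong (ℕ._* 5 ^ k) (5^even α)) (ℕ.*-comm (25 ^ α) (5 ^ k)))

open import Data.Nat using (_+_; _*_)

theorem3p20 : (α n : ℕ) →
    b 5 (4 * 5 ^ (2 * α + 1) * n + (31 * 5 ^ (2 * α) ∸ 1) / 6) % 2 ≡ 0
    × b 5 (4 * 5 ^ (2 * α + 1) * n + (79 * 5 ^ (2 * α) ∸ 1) / 6) % 2 ≡ 0
    × b 5 (4 * 5 ^ (2 * α + 2) * n + (83 * 5 ^ (2 * α + 1) ∸ 1) / 6) % 2 ≡ 0
    × b 5 (4 * 5 ^ (2 * α + 2) * n + (107 * 5 ^ (2 * α + 1) ∸ 1) / 6) % 2 ≡ 0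
-- The second arguments come from 31 = 7 + 24 · 1, 79 = 7 + 24 · 3, 83 · 5 = 7 + 24 · 17 and 107 · 5
-- = 7 + 24 · 22. Modulo 5, 31 and 79 are 1 and 4, which 2x² never takes; 83 and 107 are 3 and 2,
-- the non-squares.
theorem3p20 α n = even₁ 31 1 refl (from-yes (avoids? 2 1)) , even₁ 79 3 refl (from-yes (avoids? 2 4))
                , even₂ 83 17 refl (from-yes (avoids? 1 3)) , even₂ 107 22 refl (from-yes (avoids? 1 2))
  where
  ring₁ : ∀ c n → c + 24 * n * 5 ≡ 24 * 5 * n + c
  ring₁ = ℕRing.solve-∀
  ring₂ : ∀ c n → 5 * (c + 24 * n * 5) ≡ 24 * 25 * n + c * 5
  ring₂ = ℕRing.solve-∀

  even₁ : ∀ c d → c ≡ 7 + 24 * d → Avoids 2 (c % 5) →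
    b 5 (4 * 5 ^ (2 * α + 1) * n + (c * 5 ^ (2 * α) ∸ 1) / 6) % 2 ≡ 0
  even₁ c d refl avoid = trans
    (cong₂ (λ u v → b 5 (4 * u * n + (c * v ∸ 1) / 6) % 2) (5^even+ α 1) (5^even α))
    (b-even 5 d α n (¬represented c (24 * n) avoid ∘ subst Represented (sym (ring₁ c n))))

  even₂ : ∀ c d → c * 5 ≡ 7 + 24 * d → Avoids 1 (c % 5) →
    b 5 (4 * 5 ^ (2 * α + 2) * n + (c * 5 ^ (2 * α + 1) ∸ 1) / 6) % 2 ≡ 0
  even₂ c d p avoid = trans
    (cong₂ (λ u v → b 5 (4 * u * n + (v ∸ 1) / 6) % 2) (5^even+ α 2)
      (trans (cong (c *_) (5^even+ α 1)) (trans (sym (ℕ.*-assoc c 5 (25 ^ α))) (cong (ℕ._* 25 ^ α) p))))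
    (b-even 25 d α n (¬represented-5* c (24 * n) avoid
      ∘ subst Represented (sym (trans (ring₂ c n) (cong (λ z → 24 * 25 * n + z) p)))))
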